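{- Consider the online bin covering problem with advice, and the advice strategy $\mathsf{DH}^{b+\lg n}_2$ (with $k=2$) described in the context, where the oracle supplies exact values of $m$ and $x_m$ (with $m$ chosen by the oracle, as described, to maximize the number of bins covered by the strategy). Then for every input sequence $\sigma$ of length $n$, $$|\mathsf{DH}^{b+\lg n}_2(\sigma)| \ge \frac{3}{5}\,|\mathsf{OPT}(\sigma)| - \frac{19}{15},$$ where $|\mathsf{OPT}(\sigma)|$ is the maximum number of bins that can be covered with the items of $\sigma$ and $|\mathsf{DH}^{b+\lg n}_2(\sigma)|$ is the number of bins covered by the strategy.
   Context: Bin covering: given a sequence $\sigma$ of items with rational sizes, each item size $v$ satisfying $0<v<1$, partition the items into bins; the load of a bin is the sum of its item sizes and a bin is covered if its load is at least $1$; the goal is to maximize the number of covered bins. Online: items arrive one by one and each must be irrevocably placed in a bin (existing or newly opened) before the next arrives. Advice model: an oracle knowing the entire input and the strategy writes a bit string (using a self-delimiting encoding) on an advice tape which the strategy may read. Dual Next Fit (DNF) on a stream of items: keep one active bin, put each item into it, and when it becomes covered close it and open a new empty active bin. Fix an integer $k\ge 2$. For an integer $2\le t\le k$, an item $v$ is a $t$-item if $1/t\le v<1/(t-1)$; an item $v<1/k$ is small. Let $x_1\ge x_2\ge\dots\ge x_n$ be the items of $\sigma$ sorted in non-increasing order. Strategy $\mathsf{DH}^{b+\lg n}_k$: it first reads from the advice an integer $m$ and the value $x_m$ (the $m$-th largest item of $\sigma$). It opens $m$ critical bins, each with an initial virtual load of $x_m$; it also opens one $t$-bin for each $t\in\{2,\dots,k\}$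 and one small bin. The virtual load of a critical bin equals the sum of its small items plus either $x_m$ (if it contains no item of size $\ge x_m$ yet) or the actual size of the item of size $\ge x_m$ it contains. When an item $v$ arrives: (1) if $x_m\le v$, place $v$ in the next critical bin that does not yet contain such a (2-)item and update its virtual load; (2) if $1/k\le v<x_m$ and $v$ is a $t$-item, place $v$ in the current $t$-bin using DNF (when it becomes covered, close it and open a new $t$-bin); (3) if $v<1/k$, place $v$ in the next critical bin whose virtual load is still below $1$ and update its virtual load; if all critical bins have virtual load at least $1$, place $v$ in the small bin using DNF (when it becomes covered, close it and open a new small bin). The oracle chooses $m$ by emulating the strategy for every integer $0\le m\le n_2$, where $n_2$ is the number of $2$-items in $\sigma$, and reports a value of $m$ for which the strategy covers as many bins as possible, together with the exact value $x_m$. -}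

module Defs where

open import Data.Bool.Base using (if_then_else_)
open import Data.Integer.Base using (+_)
open import Data.List.Base using (List; []; _∷_; _++_; [_]; map; concatMap; foldl; foldr; filter; length; upTo; drop; head; replicate)
open import Data.List.Extrema using (argmax; max)
open import Data.List.Sort using (sort)
open import Data.Maybe.Base as Maybe using (Maybe; just; nothing; fromMaybe; maybe′; is-nothing)
open import Data.Nat.Base as ℕ using (ℕ; zero; suc; NonTrivial; nonTrivial⇒nonZero)
import Data.Nat.Properties as ℕ
open import Data.Product.Base using (_×_; _,_; proj₂)
open import Data.Rational.Base using (ℚ; 0ℚ; 1ℚ; _+_; _/_; _≤_; _<_)
open import Data.Rational.Properties using (_≤?_; _<?_; ≤-decTotalOrder)
open import Relation.Binary.Construct.Flip.EqAndOrd using (decTotalOrder)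
open import Relation.Nullary.Decidable using (does; _×-dec_)
open import Relation.Unary using (Decidable)

fromℕ : ℕ → ℚ
fromℕ n = + n / 1

IsItem : ℚ → Set
IsItem v = 0ℚ < v × v < 1ℚ

Bin : Set
Bin = List ℚ

load : Bin → ℚ
load = foldr _+_ 0ℚ

Covered : Bin → Set
Covered b = 1ℚ ≤ load b

covered? : Decidable Covered
covered? b = 1ℚ ≤? load b

#covered : List Bin → ℕ
#covered bs = length (filter covered? bs)

intoSomeBin : ℚ → List Bin → List (List Bin)
intoSomeBin v []       = []
intoSomeBin v (b ∷ bs) = ((v ∷ b) ∷ bs) ∷ map (b ∷_) (intoSomeBin v bs)

-- All partitions of the items into (nonempty) bins: every item either
-- starts a bin of its own or joins one of the bins of a packing of the
-- remaining items.
packings : List ℚ → List (List Bin)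
packings []      = [ [] ]
packings (v ∷ σ) = concatMap (λ bs → ([ v ] ∷ bs) ∷ intoSomeBin v bs) (packings σ)

∣OPT∣ : List ℚ → ℕ
∣OPT∣ σ = max ℕ.≤-totalOrder 0 (map #covered (packings σ))

record DNF : Set where
  constructor dnf
  field
    active : Bin
    closed : List Bin

emptyDNF : DNF
emptyDNF = dnf [] []

insertDNF : ℚ → DNF → DNF
insertDNF v (dnf b bs) =
  if does (covered? (v ∷ b)) then dnf [] ((v ∷ b) ∷ bs) else dnf (v ∷ b) bs

binsDNF : DNF → List Bin
binsDNF (dnf b bs) = b ∷ bs

-- IsTypeItem j v says that v is a t-item for t = 2 + j; the shift by 2
-- keeps both denominators t and t - 1 visibly nonzero.
IsTypeItem : ℕ → ℚ → Set
IsTypeItem j v = (+ 1 / suc (suc j)) ≤ v × v < (+ 1 / suc j)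

isTypeItem? : ∀ j → Decidable (IsTypeItem j)
isTypeItem? j v = ((+ 1 / suc (suc j)) ≤? v) ×-dec (v <? (+ 1 / suc j))

IsSmall : (k : ℕ) .{{_ : NonTrivial k}} → ℚ → Set
IsSmall k v = v < (_/_ (+ 1) k {{nonTrivial⇒nonZero k}})

isSmall? : (k : ℕ) .{{_ : NonTrivial k}} → Decidable (IsSmall k)
isSmall? k v = v <? (_/_ (+ 1) k {{nonTrivial⇒nonZero k}})

-- `large` is the item of size at least x_m, if it has arrived already.
record CriticalBin : Set where
  constructor critical
  field
    large  : Maybe ℚ
    smalls : List ℚ

open CriticalBin public

contents : CriticalBin → Bin
contents (critical l ss) = maybe′ (_∷ ss) ss l

virtualLoad : (xₘ : ℚ) → CriticalBin → ℚ
virtualLoad xₘ (critical l ss) = fromMaybe xₘ l + load ss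

-- The results below are `nothing` if no critical bin can take the item.

placeLarge : ℚ → List CriticalBin → Maybe (List CriticalBin)
placeLarge v []       = nothing
placeLarge v (c ∷ cs) =
  if is-nothing (large c)
  then just (critical (just v) (smalls c) ∷ cs)
  else Maybe.map (c ∷_) (placeLarge v cs)

placeSmall : (xₘ : ℚ) → ℚ → List CriticalBin → Maybe (List CriticalBin)
placeSmall xₘ v []       = nothing
placeSmall xₘ v (c ∷ cs) =
  if does (virtualLoad xₘ c <? 1ℚ)
  then just (critical (large c) (v ∷ smalls c) ∷ cs)
  else Maybe.map (c ∷_) (placeSmall xₘ v cs)

-- `typed` pairs each j with the stream of (2 + j)-bins.
record State : Set where
  constructor state
  field
    criticals : List CriticalBin
    typed     : List (ℕ × DNF)
    small     : DNF

initial : (k m : ℕ) → State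
initial k m = state
  (replicate m (critical nothing []))
  (map (λ j → j , emptyDNF) (upTo (k ℕ.∸ 1)))
  emptyDNF

insertTyped : ℚ → List (ℕ × DNF) → List (ℕ × DNF)
insertTyped v = map λ (j , d) → j , (if does (isTypeItem? j v) then insertDNF v d else d)

module _ (k : ℕ) .{{_ : NonTrivial k}} (xₘ : ℚ) where

  stepSmall : State → ℚ → State
  stepSmall (state cs ts s) v =
    maybe′ (λ cs′ → state cs′ ts s) (state cs ts (insertDNF v s)) (placeSmall xₘ v cs)

  stepTyped : State → ℚ → State
  stepTyped (state cs ts s) v = state cs (insertTyped v ts) s

  -- With ties at x_m more than m items have size at least x_m; those
  -- that arrive after every critical bin has received its large item are
  -- treated as ordinary t-items.
  stepLarge : State → ℚ → State
  stepLarge st@(state cs ts s) v =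
    maybe′ (λ cs′ → state cs′ ts s) (stepTyped st v) (placeLarge v cs)

  step : State → ℚ → State
  step st v =
    if does (xₘ ≤? v) then stepLarge st v
    else if does (isSmall? k v) then stepSmall st v
    else stepTyped st v

allBins : State → List Bin
allBins (state cs ts s) = map contents cs ++ concatMap (λ p → binsDNF (proj₂ p)) ts ++ binsDNF s

strategy : (k : ℕ) .{{_ : NonTrivial k}} (m : ℕ) (xₘ : ℚ) → List ℚ → List Bin
strategy k m xₘ σ = allBins (foldl (step k xₘ) (initial k m) σ)

sortDescending : List ℚ → List ℚ
sortDescending = sort (decTotalOrder ≤-decTotalOrder)

-- nthLargest σ m is x_m for 1 ≤ m ≤ length σ.  By convention x_0 = 1, so
-- that without critical bins no item counts as critical.
nthLargest : List ℚ → ℕ → ℚ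
nthLargest σ zero    = 1ℚ
nthLargest σ (suc i) = fromMaybe 1ℚ (head (drop i (sortDescending σ)))

#2-items : List ℚ → ℕ
#2-items σ = length (filter (isTypeItem? 0) σ)

#coveredWith : (k : ℕ) .{{_ : NonTrivial k}} → List ℚ → ℕ → ℕ
#coveredWith k σ m = #covered (strategy k m (nthLargest σ m) σ)

oracle : (k : ℕ) .{{_ : NonTrivial k}} → List ℚ → ℕ
oracle k σ = argmax ℕ.≤-totalOrder (#coveredWith k σ) 0 (upTo (suc (#2-items σ)))

DH : (k : ℕ) .{{_ : NonTrivial k}} → List ℚ → List Bin
DH k σ = strategy k m (nthLargest σ m) σ
  where m = oracle k σ

∣DH∣ : (k : ℕ) .{{_ : NonTrivial k}} → List ℚ → ℕ
∣DH∣ k σ = #covered (DH k σ)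

{-# OPTIONS --safe #-}

-- Let A, B and C be the numbers of bins covered by OPT with exactly one, several
-- and no big items, put a = 1 - xₘ, and clip every small item at a.  Fewer than m
-- items exceed xₘ, so at least A - m + 1 of the A bins contain clipped small items
-- of total at least a, and each of the C bins contains at least 2a of them.  A
-- critical bin takes at most 2a of clipped size, and less than a unless it gets
-- filled, so every critical bin gets filled as soon as 3m ≤ A + 2C + 2.  The true
-- small load of a critical bin is at most a + 1/2, and at most 3/2 per bin closed
-- by Dual Next Fit.  If A ≤ 4C + 1, take m = ⌈A/2⌉; otherwise m = ⌈(A + 2C)/3⌉
-- suffices even without counting the small bins.  Either way
-- 3 |OPT| ≤ 5 |DH| + 6.
module Submission where

open import Data.Bool.Base using (if_then_else_)
open import Data.Integer.Base using (+_)
import Data.Integer.Base as ℤ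
import Data.Integer.Properties as ℤ
open import Data.List.Base using (List; []; _∷_; _++_; [_]; map; concat; filter; length; foldl; replicate; head; drop; upTo)
open import Data.List.Membership.Propositional using (_∈_)
open import Data.List.Membership.Propositional.Properties using (∈-filter⁻; ∈-map⁻; ∈-upTo⁺)
open import Data.List.Extrema using (argmax-sel; f[xs]≤f[argmax])
open import Data.List.Properties using (filter-all; filter-none; length-filter; length-map; ++-identityʳ; filter-some; map-id; length-replicate; map-++; filter-++; length-++; filter-accept; filter-reject)
open import Data.List.Relation.Unary.All as All using (All; []; _∷_)
import Data.List.Relation.Unary.All.Properties as All
open import Data.List.Relation.Unary.Any as Any using (Any; here; there)
open import Data.List.Relation.Binary.Permutation.Propositional using (_↭_; ↭⇒↭ₛ; ↭-refl; ↭-sym; ↭-trans; prep)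
open import Data.List.Relation.Binary.Permutation.Propositional.Properties using (↭-length; filter-↭; map⁺; ++⁺ˡ; shift; All-resp-↭; ∈-resp-↭)
open import Data.List.Relation.Unary.AllPairs using (AllPairs; []; _∷_)
open import Data.List.Relation.Unary.Sorted.TotalOrder.Properties using (Sorted⇒AllPairs)
open import Data.List.Sort using (sort-↭; sort-↗)
open import Data.Maybe.Base as Maybe using (just; nothing; fromMaybe; maybe′)
open import Data.Nat.Tactic.RingSolver using () renaming (solve-∀ to ℕ-solve-∀)
open import Data.Nat.Base as ℕ using (ℕ; zero; suc; nonTrivial)
import Data.Nat.Coprimality as ℕ
open import Data.Nat.DivMod using (m/n*n≤m; m≡m%n+[m/n]*n; m%n<n)
import Data.Nat.Properties as ℕ
open import Data.Product.Base using (_×_; _,_; proj₁; proj₂; ∃-syntax)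
open import Data.Rational.Base using (ℚ; mkℚ; 0ℚ; ½; 1ℚ; _+_; _*_; _-_; -_; _/_; _≤_; _<_; _≥_; _⊓_; *≤*; *<*; nonNegative)
open import Data.Rational.Properties
open import Data.Sum.Base as Sum using (_⊎_; inj₁; inj₂)
open import Function.Base using (id; _∘_)
open import Level using (0ℓ)
open import Relation.Binary.Bundles using (DecTotalOrder)
open import Relation.Binary.Construct.Flip.EqAndOrd using (decTotalOrder)
open import Relation.Binary.PropositionalEquality using (_≡_; refl; sym; trans; cong; cong₂; subst; subst₂; setoid)
open import Relation.Nullary using (¬_; Dec; does; yes; no; contradiction)
open import Relation.Nullary.Decidable using (dec⇒maybe)
open import Relation.Unary using (Decidable)
open import Tactic.RingSolver using (solve-∀)
open import Tactic.RingSolver.Core.AlmostCommutativeRing using (AlmostCommutativeRing; fromCommutativeRing)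
open import Defs

-- Rational arithmetic

ℚ-ring : AlmostCommutativeRing 0ℓ 0ℓ
ℚ-ring = fromCommutativeRing +-*-commutativeRing λ p → dec⇒maybe (0ℚ ≟ p)

private
  shift-p : ∀ l p → l + (p - l) ≡ p
  shift-p = solve-∀ ℚ-ring

  shift-q : ∀ p q → (q - p) + p ≡ q
  shift-q = solve-∀ ℚ-ring

  regroup : ∀ r p l → r + (p - l) ≡ (r - l) + p
  regroup = solve-∀ ℚ-ring

-- Linear arithmetic is done by certificates: known inequalities are added up to `l ≤ r`, and the
-- ring solver checks that the goal has the same difference of sides.
≤-from-difference : ∀ {l r} p q → l ≤ r → q - p ≡ r - l → p ≤ q
≤-from-difference {l} {r} p q l≤r eq = subst₂ _≤_ (shift-p l p)
  (trans (regroup r p l) (trans (cong (_+ p) (sym eq)) (shift-q p q)))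
  (+-monoˡ-≤ (p - l) l≤r)

<-from-difference : ∀ {l r} p q → l < r → q - p ≡ r - l → p < q
<-from-difference {l} {r} p q l<r eq = subst₂ _<_ (shift-p l p)
  (trans (regroup r p l) (trans (cong (_+ p) (sym eq)) (shift-q p q)))
  (+-monoˡ-< (p - l) l<r)

p≤q⇒0≤q-p : ∀ {p q} → p ≤ q → 0ℚ ≤ q - p
p≤q⇒0≤q-p {p} {q} p≤q = subst (_≤ q - p) (+-inverseʳ p) (+-monoˡ-≤ (- p) p≤q)

<⇒≱ : ∀ {p q} → p < q → ¬ (q ≤ p)
<⇒≱ p<q q≤p = <-irrefl refl (<-≤-trans p<q q≤p)

-- `n / 1` is normalised through a gcd that is stuck for a variable `n`; the explicit `mkℚ` lets the
-- operations and the order on `ℚ` unfold.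
fromℕ≡mkℚ : ∀ n → fromℕ n ≡ mkℚ (+ n) 0 (ℕ.sym (ℕ.1-coprimeTo n))
fromℕ≡mkℚ n = normalize-coprime (ℕ.sym (ℕ.1-coprimeTo n))

fromℕ-+ : ∀ m n → fromℕ (m ℕ.+ n) ≡ fromℕ m + fromℕ n
fromℕ-+ m n rewrite fromℕ≡mkℚ m | fromℕ≡mkℚ n =
  cong (_/ 1) (sym (cong₂ ℤ._+_ (ℤ.*-identityʳ (+ m)) (ℤ.*-identityʳ (+ n))))

fromℕ-* : ∀ m n → fromℕ (m ℕ.* n) ≡ fromℕ m * fromℕ n
fromℕ-* m n rewrite fromℕ≡mkℚ m | fromℕ≡mkℚ n = cong (_/ 1) (ℤ.pos-* m n)

fromℕ-mono-≤ : ∀ {m n} → m ℕ.≤ n → fromℕ m ≤ fromℕ n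
fromℕ-mono-≤ {m} {n} m≤n rewrite fromℕ≡mkℚ m | fromℕ≡mkℚ n =
  *≤* (ℤ.*-monoʳ-≤-nonNeg (+ 1) (ℤ.+≤+ m≤n))

fromℕ-cancel-< : ∀ {m n} → fromℕ m < fromℕ n → m ℕ.< n
fromℕ-cancel-< {m} {n} m<n = ℕ.≰⇒> λ n≤m → <⇒≱ m<n (fromℕ-mono-≤ n≤m)

0≤fromℕ : ∀ n → 0ℚ ≤ fromℕ n
0≤fromℕ n = fromℕ-mono-≤ {0} {n} ℕ.z≤n

*-monoʳ-≤ : ∀ {p q} r → 0ℚ ≤ r → p ≤ q → p * r ≤ q * r
*-monoʳ-≤ r 0≤r = *-monoʳ-≤-nonNeg r {{nonNegative 0≤r}}

*-nonNeg : ∀ {p} q → 0ℚ ≤ p → 0ℚ ≤ q → 0ℚ ≤ p * q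
*-nonNeg {p} q 0≤p 0≤q = subst (_≤ p * q) (*-zeroˡ q) (*-monoʳ-≤ q 0≤q 0≤p)

+-nonNeg : ∀ {p q} → 0ℚ ≤ p → 0ℚ ≤ q → 0ℚ ≤ p + q
+-nonNeg = +-mono-≤

-- Loads

load-++ : ∀ xs ys → load (xs ++ ys) ≡ load xs + load ys
load-++ []       ys = sym (+-identityˡ (load ys))
load-++ (x ∷ xs) ys = trans (cong (_+_ x) (load-++ xs ys)) (sym (+-assoc x (load xs) (load ys)))

load-↭ : ∀ {xs ys} → xs ↭ ys → load xs ≡ load ys
load-↭ xs↭ys = foldr-commMonoid +-0-isCommutativeMonoid (↭⇒↭ₛ xs↭ys)
  where open import Data.List.Relation.Binary.Permutation.Setoid.Properties (setoid ℚ) using (foldr-commMonoid)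

IsBig : ℚ → Set
IsBig = IsTypeItem 0

isBig? : Decidable IsBig
isBig? = isTypeItem? 0

smallItems : List ℚ → List ℚ
smallItems = filter (isSmall? 2)

smallLoad : (ℚ → ℚ) → List ℚ → ℚ
smallLoad φ σ = load (map φ (smallItems σ))

smallLoad-++ : ∀ φ σ τ → smallLoad φ (σ ++ τ) ≡ smallLoad φ σ + smallLoad φ τ
smallLoad-++ φ σ τ = trans (cong (load ∘ map φ) (filter-++ (isSmall? 2) σ τ))
  (trans (cong load (map-++ φ (smallItems σ) (smallItems τ))) (load-++ (map φ (smallItems σ)) _))

smallLoad-↭ : ∀ φ {σ τ} → σ ↭ τ → smallLoad φ σ ≡ smallLoad φ τ
smallLoad-↭ φ σ↭τ = load-↭ (map⁺ φ (filter-↭ (isSmall? 2) σ↭τ))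

small⇒¬big : ∀ {v} → IsSmall 2 v → ¬ IsBig v
small⇒¬big v<½ (½≤v , _) = <⇒≱ v<½ ½≤v

¬small⇒big : ∀ {v} → IsItem v → ¬ IsSmall 2 v → IsBig v
¬small⇒big (_ , v<1) v≮½ = ≮⇒≥ v≮½ , v<1

load-nonNeg : ∀ {vs} → All (0ℚ ≤_) vs → 0ℚ ≤ load vs
load-nonNeg []          = ≤-refl
load-nonNeg (0≤v ∷ 0≤vs) = +-nonNeg 0≤v (load-nonNeg 0≤vs)

-- Small items clipped at a capacity

-- Clipping is subadditive: a summand that reaches `a` already supplies all of `a`, and otherwise
-- the right side is the unclipped sum.
⊓-superadditive : ∀ {v l a} → 0ℚ ≤ v → 0ℚ ≤ l → 0ℚ ≤ a → (v + l) ⊓ a ≤ (v ⊓ a) + (l ⊓ a)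
⊓-superadditive {v} {l} {a} 0≤v 0≤l 0≤a with ≤-total v a | ≤-total l a
... | inj₂ a≤v | _ rewrite p≥q⇒p⊓q≡q a≤v = ≤-trans (p⊓q≤q (v + l) a)
  (subst (_≤ a + (l ⊓ a)) (+-identityʳ a) (+-monoʳ-≤ a (⊓-glb 0≤l 0≤a)))
... | inj₁ v≤a | inj₁ l≤a rewrite p≤q⇒p⊓q≡p v≤a | p≤q⇒p⊓q≡p l≤a = p⊓q≤p (v + l) a
... | inj₁ v≤a | inj₂ a≤l rewrite p≤q⇒p⊓q≡p v≤a | p≥q⇒p⊓q≡q a≤l = ≤-trans (p⊓q≤q (v + l) a)
  (subst (_≤ v + a) (+-identityˡ a) (+-monoˡ-≤ a 0≤v))

load-⊓ : ∀ {a vs} → 0ℚ ≤ a → All (0ℚ ≤_) vs → load vs ⊓ a ≤ load (map (_⊓ a) vs)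
load-⊓ {a} 0≤a [] = p⊓q≤p 0ℚ a
load-⊓ {a} 0≤a (_∷_ {v} {vs} 0≤v 0≤vs) = ≤-trans
  (⊓-superadditive 0≤v (load-nonNeg 0≤vs) 0≤a) (+-monoʳ-≤ (v ⊓ a) (load-⊓ 0≤a 0≤vs))

load-map-⊓≤load : ∀ a vs → load (map (_⊓ a) vs) ≤ load vs
load-map-⊓≤load a []       = ≤-refl
load-map-⊓≤load a (v ∷ vs) = +-mono-≤ (p⊓q≤p v a) (load-map-⊓≤load a vs)

-- `2a ≤ 1` gives the bound by `v`, and `2v ≤ 1` the bound by `a`. Clipping thus keeps at least a
-- fraction `2a` of each small item, hence at least `2a` of a bin covered by small items alone.
double-scale≤⊓ : ∀ {v a} → 0ℚ ≤ v → v ≤ ½ → 0ℚ ≤ a → a ≤ ½ → v * (a + a) ≤ v ⊓ a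
double-scale≤⊓ {v} {a} 0≤v v≤½ 0≤a a≤½ = ⊓-glb
  (≤-from-difference (v * (a + a)) v (*-monoʳ-≤ v 0≤v (+-mono-≤ a≤½ a≤½)) (eq₁ v a))
  (≤-from-difference (v * (a + a)) a (*-monoʳ-≤ a 0≤a (+-mono-≤ v≤½ v≤½)) (eq₂ v a))
  where
  eq₁ : ∀ v a → v - v * (a + a) ≡ (½ + ½) * v - (a + a) * v
  eq₁ = solve-∀ ℚ-ring
  eq₂ : ∀ v a → a - v * (a + a) ≡ (½ + ½) * a - (v + v) * a
  eq₂ = solve-∀ ℚ-ring

double-scale-load : ∀ {a vs} → 0ℚ ≤ a → a ≤ ½ → All (0ℚ ≤_) vs → All (_≤ ½) vs →
                    load vs * (a + a) ≤ load (map (_⊓ a) vs)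
double-scale-load {a} 0≤a a≤½ [] [] = ≤-reflexive (*-zeroˡ (a + a))
double-scale-load {a} 0≤a a≤½ (_∷_ {v} {vs} 0≤v 0≤vs) (v≤½ ∷ vs≤½) =
  subst (_≤ load (map (_⊓ a) (v ∷ vs))) (sym (*-distribʳ-+ (a + a) v (load vs)))
    (+-mono-≤ (double-scale≤⊓ 0≤v v≤½ 0≤a a≤½) (double-scale-load 0≤a a≤½ 0≤vs vs≤½))

-- The profile of a packing

#above : ℚ → List ℚ → ℕ
#above x σ = length (filter (x <?_) σ)

-- Each item above `x` earns a credit of `1ℚ - x`, which stands for the small items that its bin may
-- lack.
weight : (φ : ℚ → ℚ) (x : ℚ) → List ℚ → ℚ
weight φ x σ = smallLoad φ σ + fromℕ (#above x σ) * (1ℚ - x)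

-- `clipped` serves to show that the critical bins get filled, `plain` to bound from below the
-- number of bins covered by Dual Next Fit on small items.
record WeightBound (A C : ℕ) (x : ℚ) (σ : List ℚ) : Set where
  field
    clipped : fromℕ A * (1ℚ - x) + fromℕ C * ((1ℚ - x) + (1ℚ - x)) ≤ weight (_⊓ (1ℚ - x)) x σ
    plain   : fromℕ A * (1ℚ - x) + fromℕ C * 1ℚ ≤ weight id x σ

-- Among the n covered bins of a packing of σ, exactly A contain one big
-- item, B contain several and C contain none.
record Profile (n : ℕ) (σ : List ℚ) : Set where
  field
    A B C : ℕ
    total : n ≡ A ℕ.+ B ℕ.+ C
    bigs  : A ℕ.+ 2 ℕ.* B ℕ.≤ #2-items σ
    -- Stated for all `x` at once, since `m`, and with it the threshold, is chosen only after `A`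
    -- and `C` are known.
    bound : ∀ {x} → ½ ≤ x → x ≤ 1ℚ → WeightBound A C x σ

length-filter-++ : ∀ {I : Set} {P : I → Set} (P? : Decidable P) σ τ →
  length (filter P? (σ ++ τ)) ≡ length (filter P? σ) ℕ.+ length (filter P? τ)
length-filter-++ P? σ τ = trans (cong length (filter-++ P? σ τ)) (length-++ (filter P? σ))

length-filter-↭ : ∀ {I : Set} {P : I → Set} (P? : Decidable P) {σ τ} → σ ↭ τ →
  length (filter P? σ) ≡ length (filter P? τ)
length-filter-↭ P? σ↭τ = ↭-length (filter-↭ P? σ↭τ)

weight-++ : ∀ φ x σ τ → weight φ x (σ ++ τ) ≡ weight φ x σ + weight φ x τ
weight-++ φ x σ τ = trans
  (cong₂ (λ s n → s + n * (1ℚ - x)) (smallLoad-++ φ σ τ)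
    (trans (cong fromℕ (length-filter-++ (x <?_) σ τ)) (fromℕ-+ (#above x σ) (#above x τ))))
  (eq (smallLoad φ σ) (smallLoad φ τ) (fromℕ (#above x σ)) (fromℕ (#above x τ)) (1ℚ - x))
  where
  eq : ∀ s t m n a → s + t + (m + n) * a ≡ s + m * a + (t + n * a)
  eq = solve-∀ ℚ-ring

weight-↭ : ∀ φ x {σ τ} → σ ↭ τ → weight φ x σ ≡ weight φ x τ
weight-↭ φ x σ↭τ = cong₂ (λ s n → s + fromℕ n * (1ℚ - x)) (smallLoad-↭ φ σ↭τ) (length-filter-↭ (x <?_) σ↭τ)

Profile-↭ : ∀ {n σ τ} → σ ↭ τ → Profile n σ → Profile n τ
Profile-↭ σ↭τ p = record
  { Profile p
  ; bigs  = subst (_ ℕ.≤_) (length-filter-↭ isBig? σ↭τ) bigs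
  ; bound = λ {x} ½≤x x≤1 → record
    { clipped = subst (_ ≤_) (weight-↭ _ x σ↭τ) (WeightBound.clipped (bound ½≤x x≤1))
    ; plain   = subst (_ ≤_) (weight-↭ _ x σ↭τ) (WeightBound.plain (bound ½≤x x≤1))
    }
  }
  where open Profile p

private
  merge-totals : ∀ A B C A′ B′ C′ →
    A ℕ.+ B ℕ.+ C ℕ.+ (A′ ℕ.+ B′ ℕ.+ C′) ≡ (A ℕ.+ A′) ℕ.+ (B ℕ.+ B′) ℕ.+ (C ℕ.+ C′)
  merge-totals = ℕ-solve-∀

  merge-bigs : ∀ A B A′ B′ →
    (A ℕ.+ 2 ℕ.* B) ℕ.+ (A′ ℕ.+ 2 ℕ.* B′) ≡ (A ℕ.+ A′) ℕ.+ 2 ℕ.* (B ℕ.+ B′)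
  merge-bigs = ℕ-solve-∀

  merge-products : ∀ A C A′ C′ a c → (A * a + C * c) + (A′ * a + C′ * c) ≡ (A + A′) * a + (C + C′) * c
  merge-products = solve-∀ ℚ-ring

merge-bounds : ∀ {A C A′ C′ φ x σ τ} c →
  fromℕ A * (1ℚ - x) + fromℕ C * c ≤ weight φ x σ →
  fromℕ A′ * (1ℚ - x) + fromℕ C′ * c ≤ weight φ x τ →
  fromℕ (A ℕ.+ A′) * (1ℚ - x) + fromℕ (C ℕ.+ C′) * c ≤ weight φ x (σ ++ τ)
merge-bounds {A} {C} {A′} {C′} {φ} {x} {σ} {τ} c p q = subst₂ _≤_
  (trans (merge-products (fromℕ A) (fromℕ C) (fromℕ A′) (fromℕ C′) (1ℚ - x) c)
    (sym (cong₂ (λ m n → m * (1ℚ - x) + n * c) (fromℕ-+ A A′) (fromℕ-+ C C′))))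
  (sym (weight-++ φ x σ τ))
  (+-mono-≤ p q)

Profile-++ : ∀ {m n σ τ} → Profile m σ → Profile n τ → Profile (m ℕ.+ n) (σ ++ τ)
Profile-++ {σ = σ} {τ} p q = record
  { A = P.A ℕ.+ Q.A
  ; B = P.B ℕ.+ Q.B
  ; C = P.C ℕ.+ Q.C
  ; total = trans (cong₂ ℕ._+_ P.total Q.total) (merge-totals P.A P.B P.C Q.A Q.B Q.C)
  ; bigs  = subst₂ ℕ._≤_ (merge-bigs P.A P.B Q.A Q.B) (sym (length-filter-++ isBig? σ τ)) (ℕ.+-mono-≤ P.bigs Q.bigs)
  ; bound = λ {x} ½≤x x≤1 → record
    { clipped = merge-bounds {P.A} {P.C} {Q.A} {Q.C} {_} {x} {σ} {τ} ((1ℚ - x) + (1ℚ - x))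
        (WeightBound.clipped (P.bound ½≤x x≤1)) (WeightBound.clipped (Q.bound ½≤x x≤1))
    ; plain   = merge-bounds {P.A} {P.C} {Q.A} {Q.C} {_} {x} {σ} {τ} 1ℚ
        (WeightBound.plain (P.bound ½≤x x≤1)) (WeightBound.plain (Q.bound ½≤x x≤1))
    }
  }
  where
  module P = Profile p
  module Q = Profile q

#above-nonNeg : ∀ {x} σ → x ≤ 1ℚ → 0ℚ ≤ fromℕ (#above x σ) * (1ℚ - x)
#above-nonNeg {x} σ x≤1 = *-nonNeg (1ℚ - x) (0≤fromℕ (#above x σ)) (p≤q⇒0≤q-p x≤1)

smallItems-nonNeg : ∀ {σ} → All IsItem σ → All (0ℚ ≤_) (smallItems σ)
smallItems-nonNeg = All.filter⁺ (isSmall? 2) ∘ All.map (<⇒≤ ∘ proj₁)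

smallItems≤½ : ∀ σ → All (_≤ ½) (smallItems σ)
smallItems≤½ σ = All.map <⇒≤ (All.all-filter (isSmall? 2) σ)

load-small+big : ∀ {σ} → All IsItem σ → load σ ≡ load (smallItems σ) + load (filter isBig? σ)
load-small+big [] = refl
load-small+big (_∷_ {v} {σ} item items) with v <? ½
... | yes v<½
  rewrite filter-accept (isSmall? 2) {xs = σ} v<½ | filter-reject isBig? {xs = σ} (small⇒¬big v<½)
        | load-small+big items =
  sym (+-assoc v (load (smallItems σ)) (load (filter isBig? σ)))
... | no v≮½
  rewrite filter-reject (isSmall? 2) {xs = σ} v≮½ | filter-accept isBig? {xs = σ} (¬small⇒big item v≮½)
        | load-small+big items =
  eq v (load (smallItems σ)) (load (filter isBig? σ))
  where
  eq : ∀ v s t → v + (s + t) ≡ s + (v + t)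
  eq = solve-∀ ℚ-ring

private
  vanishing : ∀ a c → 0ℚ * a + 0ℚ * c ≡ 0ℚ
  vanishing = solve-∀ ℚ-ring

  first : ∀ a c → 1ℚ * a + 0ℚ * c ≡ a
  first = solve-∀ ℚ-ring

  second : ∀ a c → 0ℚ * a + 1ℚ * c ≡ c
  second = solve-∀ ℚ-ring

smallLoad-⊓≤smallLoad : ∀ a σ → smallLoad (_⊓ a) σ ≤ smallLoad id σ
smallLoad-⊓≤smallLoad a σ = subst (λ vs → smallLoad (_⊓ a) σ ≤ load vs) (sym (map-id (smallItems σ)))
  (load-map-⊓≤load a (smallItems σ))

-- The weight of a single bin

module _ {x : ℚ} {b : Bin} (items : All IsItem b) (½≤x : ½ ≤ x) (x≤1 : x ≤ 1ℚ) where

  private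
    a = 1ℚ - x

    0≤a : 0ℚ ≤ a
    0≤a = p≤q⇒0≤q-p x≤1

    a≤½ : a ≤ ½
    a≤½ = +-monoʳ-≤ 1ℚ (neg-antimono-≤ ½≤x)

  weight-⊓≤weight : weight (_⊓ a) x b ≤ weight id x b
  weight-⊓≤weight = +-monoˡ-≤ (fromℕ (#above x b) * a) (smallLoad-⊓≤smallLoad a b)

  smallLoad≤weight : ∀ φ → smallLoad φ b ≤ weight φ x b
  smallLoad≤weight φ = subst (_≤ weight φ x b) (+-identityʳ (smallLoad φ b))
    (+-monoʳ-≤ (smallLoad φ b) (#above-nonNeg b x≤1))

  clippedWeight-nonNeg : 0ℚ ≤ weight (_⊓ a) x b
  clippedWeight-nonNeg = +-nonNeg
    (load-nonNeg (All.map⁺ (All.map (λ 0≤v → ⊓-glb 0≤v 0≤a) (smallItems-nonNeg items))))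
    (#above-nonNeg b x≤1)

  boundWithout : WeightBound 0 0 x b
  boundWithout = record
    { clipped = subst (_≤ weight (_⊓ a) x b) (sym (vanishing a (a + a))) clippedWeight-nonNeg
    ; plain   = subst (_≤ weight id x b) (sym (vanishing a 1ℚ)) (≤-trans clippedWeight-nonNeg weight-⊓≤weight)
    }

  boundOfSmall : 1ℚ ≤ load (smallItems b) → WeightBound 0 1 x b
  boundOfSmall 1≤s = record
    { clipped = subst (_≤ weight (_⊓ a) x b) (sym (second a (a + a))) (≤-trans
        (subst (_≤ load (smallItems b) * (a + a)) (*-identityˡ (a + a)) (*-monoʳ-≤ (a + a) (+-nonNeg 0≤a 0≤a) 1≤s))
        (≤-trans (double-scale-load 0≤a a≤½ (smallItems-nonNeg items) (smallItems≤½ b)) (smallLoad≤weight (_⊓ a))))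
    ; plain   = subst (_≤ weight id x b) (sym (second a 1ℚ)) (≤-trans
        (subst (1ℚ ≤_) (cong load (sym (map-id (smallItems b)))) 1≤s) (smallLoad≤weight id))
    }

  boundOfOne : ∀ {y} → filter isBig? b ≡ [ y ] → 1ℚ ≤ load (smallItems b) + y → WeightBound 1 0 x b
  boundOfOne {y} eq 1≤s+y = record
    { clipped = subst (_≤ weight (_⊓ a) x b) (sym (first a (a + a))) a≤clipped
    ; plain   = subst (_≤ weight id x b) (sym (first a 1ℚ)) (≤-trans a≤clipped weight-⊓≤weight)
    }
    where
    y∈b : y ∈ b
    y∈b = proj₁ (∈-filter⁻ isBig? {xs = b} (subst (y ∈_) (sym eq) (here refl)))

    rearrange : ∀ s x y → s - (1ℚ - x) ≡ s + y + x - (1ℚ + y)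
    rearrange = solve-∀ ℚ-ring

    a≤clipped : a ≤ weight (_⊓ a) x b
    -- A big item above `x` supplies `a` by its credit. Otherwise the small items add up to at least
    -- `1 - y ≥ a`, and clipping them one by one still leaves `a`.
    a≤clipped with x <? y
    ... | yes x<y = subst (_≤ weight (_⊓ a) x b) (trans (+-identityˡ (1ℚ * a)) (*-identityˡ a)) (+-mono-≤
      (load-nonNeg (All.map⁺ (All.map (λ 0≤v → ⊓-glb 0≤v 0≤a) (smallItems-nonNeg items))))
      (*-monoʳ-≤ a 0≤a (fromℕ-mono-≤ {1} (filter-some (x <?_) (Any.map (λ where refl → x<y) y∈b)))))
    ... | no x≮y = ≤-trans (⊓-glb a≤s ≤-refl) (≤-trans (load-⊓ 0≤a (smallItems-nonNeg items)) (smallLoad≤weight (_⊓ a)))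
      where
      a≤s : a ≤ load (smallItems b)
      a≤s = ≤-from-difference a (load (smallItems b)) (+-mono-≤ 1≤s+y (≮⇒≥ x≮y)) (rearrange (load (smallItems b)) x y)

Profile-uncovered : ∀ {b} → All IsItem b → Profile 0 b
Profile-uncovered items = record
  { A = 0 ; B = 0 ; C = 0 ; total = refl ; bigs = ℕ.z≤n ; bound = boundWithout items }

Profile-covered : ∀ {b} → All IsItem b → Covered b → Profile 1 b
Profile-covered {b} items 1≤b with filter isBig? b in eq
... | [] = record { A = 0 ; B = 0 ; C = 1 ; total = refl ; bigs = ℕ.z≤n ; bound = λ ½≤x x≤1 → boundOfSmall items ½≤x x≤1 1≤s }
  where
  1≤s : 1ℚ ≤ load (smallItems b)
  1≤s = subst (1ℚ ≤_) (trans (load-small+big items) (trans (cong (λ ys → load (smallItems b) + load ys) eq)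
    (+-identityʳ (load (smallItems b))))) 1≤b
... | y ∷ [] = record { A = 1 ; B = 0 ; C = 0 ; total = refl ; bigs = ℕ.≤-reflexive (sym (cong length eq))
                      ; bound = λ ½≤x x≤1 → boundOfOne items ½≤x x≤1 eq 1≤s+y }
  where
  1≤s+y : 1ℚ ≤ load (smallItems b) + y
  1≤s+y = subst (1ℚ ≤_) (trans (load-small+big items) (cong (_+_ (load (smallItems b)))
    (trans (cong load eq) (+-identityʳ y)))) 1≤b
... | y ∷ z ∷ ys = record { A = 0 ; B = 1 ; C = 0 ; total = refl
                          ; bigs = subst (2 ℕ.≤_) (sym (cong length eq)) (ℕ.s≤s (ℕ.s≤s ℕ.z≤n))
                          ; bound = boundWithout items }

-- From single bins to an optimal packing

Profile-packing : ∀ {bs} → All (All IsItem) bs → Profile (#covered bs) (concat bs)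
Profile-packing [] = Profile-uncovered []
Profile-packing (_∷_ {b} {bs} items rest) = extend (covered? b)
  where
  extend : Dec (Covered b) → Profile (#covered (b ∷ bs)) (b ++ concat bs)
  extend (yes 1≤b) = subst (λ cs → Profile (length cs) (b ++ concat bs)) (sym (filter-accept covered? {b} {bs} 1≤b))
    (Profile-++ (Profile-covered items 1≤b) (Profile-packing rest))
  extend (no 1≰b)  = subst (λ cs → Profile (length cs) (b ++ concat bs)) (sym (filter-reject covered? {b} {bs} 1≰b))
    (Profile-++ (Profile-uncovered items) (Profile-packing rest))

intoSomeBin-↭ : ∀ v bs → All (λ cs → concat cs ↭ v ∷ concat bs) (intoSomeBin v bs)
intoSomeBin-↭ v []       = []
intoSomeBin-↭ v (b ∷ bs) = ↭-refl ∷ All.map⁺ (All.map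
  (λ p → ↭-trans (++⁺ˡ b p) (shift v b (concat bs))) (intoSomeBin-↭ v bs))

packings-↭ : ∀ σ → All (λ bs → concat bs ↭ σ) (packings σ)
packings-↭ []      = ↭-refl ∷ []
packings-↭ (v ∷ σ) = All.concat⁺ (All.map⁺ (All.map
  (λ {bs} p → prep v p ∷ All.map (λ q → ↭-trans q (prep v p)) (intoSomeBin-↭ v bs)) (packings-↭ σ)))

Profile-OPT : ∀ {σ} → All IsItem σ → Profile (∣OPT∣ σ) σ
Profile-OPT {σ} items with argmax-sel ℕ.≤-totalOrder id 0 (map #covered (packings σ))
-- The maximum is its default value `0`; a profile of zero bins exists for every list of items.
... | inj₁ eq = subst (λ n → Profile n σ) (sym eq) (Profile-uncovered items)
... | inj₂ opt∈ with ∈-map⁻ #covered opt∈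
... | bs , bs∈ , eq = subst (λ n → Profile n σ) (sym eq)
  (Profile-↭ bs↭σ (Profile-packing {bs} (All.concat⁻ (All-resp-↭ (↭-sym bs↭σ) items))))
  where
  bs↭σ : concat bs ↭ σ
  bs↭σ = All.lookup (packings-↭ σ) bs∈

-- Dual Next Fit

-- The strategy branches on `does`; the motive `Q` marks where the conditional occurs, which
-- replaces a `with` abstraction over the decision.
if-does-elim : ∀ {A P : Set} (P? : Dec P) (Q : A → Set) {t e : A} →
               (P → Q t) → (¬ P → Q e) → Q (if does P? then t else e)
if-does-elim (yes p) Q then-case else-case = then-case p
if-does-elim (no ¬p) Q then-case else-case = else-case ¬p

-- The factor `3 / 2`: a bin is closed when an item below `½` joins a load below `1`.
record SmallDNF (s : DNF) : Set where
  open DNF s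
  field
    activeLoad    : load active < 1ℚ
    closedCovered : All Covered closed
    closedLoad    : load (concat closed) ≤ fromℕ (length closed) * (+ 3 / 2)

contentsDNF : (ℚ → ℚ) → DNF → ℚ
contentsDNF φ s = load (map φ (concat (binsDNF s)))

insertDNF-contents : ∀ φ v s → contentsDNF φ (insertDNF v s) ≡ φ v + contentsDNF φ s
insertDNF-contents φ v (dnf b bs) = if-does-elim (covered? (v ∷ b))
  (λ s → contentsDNF φ s ≡ φ v + contentsDNF φ (dnf b bs)) (λ _ → refl) (λ _ → refl)

insertDNF-small : ∀ {v s} → IsSmall 2 v → SmallDNF s → SmallDNF (insertDNF v s)
insertDNF-small {v} {dnf b bs} v<½ inv = if-does-elim (covered? (v ∷ b)) SmallDNF
  (λ 1≤v+b → record
    { activeLoad    = *<* (ℤ.+<+ (ℕ.s≤s ℕ.z≤n))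
    ; closedCovered = 1≤v+b ∷ closedCovered
    ; closedLoad    = subst₂ _≤_ (sym (load-++ (v ∷ b) (concat bs)))
        (trans (eq (fromℕ (length bs))) (cong (_* (+ 3 / 2)) (sym (fromℕ-+ 1 (length bs)))))
        (+-mono-≤ (<⇒≤ (+-mono-< v<½ activeLoad)) closedLoad)
    })
  (λ 1≰v+b → record { SmallDNF inv ; activeLoad = ≰⇒> 1≰v+b })
  where
  open SmallDNF inv
  eq : ∀ n → ½ + 1ℚ + n * (+ 3 / 2) ≡ (1ℚ + n) * (+ 3 / 2)
  eq = solve-∀ ℚ-ring

-- Two big items cover a bin, so an active bin holds at most one.
data BigDNF : DNF → Set where
  empty  : ∀ {bs} → All Covered bs → BigDNF (dnf [] bs)
  single : ∀ {u bs} → ½ ≤ u → All Covered bs → BigDNF (dnf [ u ] bs)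

-- Every closed bin is counted as two items. Only an upper bound on the number of items is wanted,
-- so it suffices that each insertion raises the count by at least one.
#itemsOf : DNF → ℕ
#itemsOf (dnf b bs) = length b ℕ.+ 2 ℕ.* length bs

insertDNF-big : ∀ {v d} → ½ ≤ v → BigDNF d → BigDNF (insertDNF v d) × suc (#itemsOf d) ℕ.≤ #itemsOf (insertDNF v d)
insertDNF-big {v} ½≤v (empty {bs} cov) = if-does-elim (covered? (v ∷ []))
  (λ d → BigDNF d × suc (2 ℕ.* length bs) ℕ.≤ #itemsOf d)
  (λ 1≤v → empty (1≤v ∷ cov) , ℕ.≤-trans (ℕ.n≤1+n _) (ℕ.≤-reflexive (sym (ℕ.*-suc 2 (length bs)))))
  (λ _ → single ½≤v cov , ℕ.≤-refl)
insertDNF-big {v} ½≤v (single {u} {bs} ½≤u cov) = if-does-elim (covered? (v ∷ u ∷ []))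
  (λ d → BigDNF d × suc (suc (2 ℕ.* length bs)) ℕ.≤ #itemsOf d)
  (λ 1≤v+u → empty (1≤v+u ∷ cov) , ℕ.≤-reflexive (sym (ℕ.*-suc 2 (length bs))))
  (λ 1≰v+u → contradiction (+-mono-≤ ½≤v (subst (½ ≤_) (sym (+-identityʳ u)) ½≤u)) 1≰v+u)

-- Critical bins

data Updated (R : CriticalBin → CriticalBin → Set) : List CriticalBin → List CriticalBin → Set where
  here  : ∀ {c c′ cs} → R c c′ → Updated R (c ∷ cs) (c′ ∷ cs)
  there : ∀ {c cs cs′} → Updated R cs cs′ → Updated R (c ∷ cs) (c ∷ cs′)

module _ {R : CriticalBin → CriticalBin → Set} where

  Updated-length : ∀ {cs cs′} → Updated R cs cs′ → length cs′ ≡ length cs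
  Updated-length (here _)  = refl
  Updated-length (there u) = cong suc (Updated-length u)

  Updated-All : ∀ {P : CriticalBin → Set} → (∀ {c c′} → R c c′ → P c → P c′) →
                ∀ {cs cs′} → Updated R cs cs′ → All P cs → All P cs′
  Updated-All f (here r)  (p ∷ ps) = f r p ∷ ps
  Updated-All f (there u) (p ∷ ps) = p ∷ Updated-All f u ps

  Updated-load : ∀ {f δ} → (∀ {c c′} → R c c′ → f c′ ≡ δ + f c) →
                 ∀ {cs cs′} → Updated R cs cs′ → load (map f cs′) ≡ δ + load (map f cs)
  Updated-load {f} {δ} h (here {c} {_} {cs} r) = trans (cong (_+ load (map f cs)) (h r)) (+-assoc δ (f c) _)
  Updated-load {f} {δ} h (there {c} {cs} u) = trans (cong (_+_ (f c)) (Updated-load {f} {δ} h u)) (eq (f c) δ (load (map f cs)))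
    where
    eq : ∀ p q r → p + (q + r) ≡ q + (p + r)
    eq = solve-∀ ℚ-ring

#lacking : List CriticalBin → ℕ
#lacking []                           = 0
#lacking (critical nothing  _ ∷ cs) = suc (#lacking cs)
#lacking (critical (just _) _ ∷ cs) = #lacking cs

data LargePlaced (v : ℚ) : CriticalBin → CriticalBin → Set where
  large-placed : ∀ {ss} → LargePlaced v (critical nothing ss) (critical (just v) ss)

data SmallPlaced (x v : ℚ) : CriticalBin → CriticalBin → Set where
  small-placed : ∀ {l ss} → virtualLoad x (critical l ss) < 1ℚ →
                 SmallPlaced x v (critical l ss) (critical l (v ∷ ss))

#lacking-large : ∀ {v cs cs′} → Updated (LargePlaced v) cs cs′ → #lacking cs ≡ suc (#lacking cs′)
#lacking-large (here large-placed)                   = refl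
#lacking-large (there {critical nothing _} u)  = cong suc (#lacking-large u)
#lacking-large (there {critical (just _) _} u) = #lacking-large u

#lacking-small : ∀ {x v cs cs′} → Updated (SmallPlaced x v) cs cs′ → #lacking cs′ ≡ #lacking cs
#lacking-small (here (small-placed {nothing} _)) = refl
#lacking-small (here (small-placed {just _} _))  = refl
#lacking-small (there {critical nothing _} u)    = cong suc (#lacking-small u)
#lacking-small (there {critical (just _) _} u)   = #lacking-small u

Full : ℚ → CriticalBin → Set
Full x c = 1ℚ ≤ virtualLoad x c

placeLarge-view : ∀ v cs → (placeLarge v cs ≡ nothing × #lacking cs ≡ 0)
                         ⊎ ∃[ cs′ ] (placeLarge v cs ≡ just cs′ × Updated (LargePlaced v) cs cs′)
placeLarge-view v [] = inj₁ (refl , refl)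
placeLarge-view v (critical nothing ss ∷ cs) = inj₂ (_ , refl , here large-placed)
placeLarge-view v (critical (just _) ss ∷ cs) with placeLarge-view v cs
... | inj₁ (eq , none)     rewrite eq = inj₁ (refl , none)
... | inj₂ (cs′ , eq , u) rewrite eq = inj₂ (_ , refl , there u)

placeSmall-view : ∀ x v cs → (placeSmall x v cs ≡ nothing × All (Full x) cs)
                           ⊎ ∃[ cs′ ] (placeSmall x v cs ≡ just cs′ × Updated (SmallPlaced x v) cs cs′)
placeSmall-view x v [] = inj₁ (refl , [])
placeSmall-view x v (c ∷ cs) = if-does-elim (virtualLoad x c <? 1ℚ)
  (λ r → (r ≡ nothing × All (Full x) (c ∷ cs)) ⊎ ∃[ cs′ ] (r ≡ just cs′ × Updated (SmallPlaced x v) (c ∷ cs) cs′))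
  (λ low → inj₂ (_ , refl , here (small-placed low)))
  (λ ¬low → Sum.map
    (λ (eq , full) → cong (Maybe.map (c ∷_)) eq , ≮⇒≥ ¬low ∷ full)
    (λ (cs′ , eq , u) → c ∷ cs′ , cong (Maybe.map (c ∷_)) eq , there u)
    (placeSmall-view x v cs))

-- Once small items overflow into the small bin, none goes into a critical bin again.
full⇒¬SmallPlaced : ∀ {x v cs cs′} → All (Full x) cs → ¬ Updated (SmallPlaced x v) cs cs′
full⇒¬SmallPlaced (full ∷ _)  (here (small-placed low)) = <⇒≱ low full
full⇒¬SmallPlaced (_ ∷ fulls) (there u)                 = full⇒¬SmallPlaced fulls u

#atLeast : ℚ → List ℚ → ℕ
#atLeast x σ = length (filter (x ≤?_) σ)

-- A small item enters only while the virtual load is below `1`, when the small items present add up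
-- to less than `1ℚ - x`. This last item then adds at most `1ℚ - x` after clipping and at most `½`
-- before.
record Bounded (x : ℚ) (c : CriticalBin) : Set where
  field
    largeBound   : x ≤ fromMaybe x (large c)
    clippedBound : load (map (_⊓ (1ℚ - x)) (smalls c)) ≤ (1ℚ - x) + (1ℚ - x)
    loadBound    : load (smalls c) ≤ (1ℚ - x) + ½

  low⇒smalls< : virtualLoad x c < 1ℚ → load (smalls c) < 1ℚ - x
  low⇒smalls< low = <-from-difference (load (smalls c)) (1ℚ - x)
    (≤-<-trans (+-monoˡ-≤ (load (smalls c)) largeBound) low) (eq (load (smalls c)) x)
    where
    eq : ∀ s x → 1ℚ - x - s ≡ 1ℚ - (x + s)
    eq = solve-∀ ℚ-ring

Bounded-small : ∀ {x v c c′} → IsSmall 2 v → SmallPlaced x v c c′ → Bounded x c → Bounded x c′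
Bounded-small {x} {v} v<½ (small-placed {l} {ss} low) bounded = record
  { largeBound   = largeBound
  ; clippedBound = +-mono-≤ (p⊓q≤q v (1ℚ - x)) (≤-trans (load-map-⊓≤load (1ℚ - x) ss) (<⇒≤ (low⇒smalls< low)))
  ; loadBound    = subst (_≤ (1ℚ - x) + ½) (+-comm (load ss) v) (+-mono-≤ (<⇒≤ (low⇒smalls< low)) (<⇒≤ v<½))
  }
  where open Bounded bounded

Bounded-large : ∀ {x v c c′} → x ≤ v → LargePlaced v c c′ → Bounded x c → Bounded x c′
Bounded-large x≤v large-placed bounded = record { Bounded bounded ; largeBound = x≤v }

-- Replacing the placeholder `x` by an actual item of size at least `x` cannot lower the virtual
-- load.
Full-large : ∀ {x v c c′} → x ≤ v → LargePlaced v c c′ → Full x c → Full x c′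
Full-large x≤v (large-placed {ss}) full = ≤-trans full (+-monoˡ-≤ (load ss) x≤v)

criticalLoad : (ℚ → ℚ) → List CriticalBin → ℚ
criticalLoad φ cs = load (map (λ c → load (map φ (smalls c))) cs)

criticalLoad-large : ∀ φ {v cs cs′} → Updated (LargePlaced v) cs cs′ → criticalLoad φ cs′ ≡ criticalLoad φ cs
criticalLoad-large φ {cs = cs} u = trans
  (Updated-load {f = λ c → load (map φ (smalls c))} {0ℚ} (λ { (large-placed {ss}) → sym (+-identityˡ (load (map φ ss))) }) u)
  (+-identityˡ (criticalLoad φ cs))

criticalLoad-small : ∀ φ {x v cs cs′} → Updated (SmallPlaced x v) cs cs′ → criticalLoad φ cs′ ≡ φ v + criticalLoad φ cs
criticalLoad-small φ {v = v} = Updated-load {f = λ c → load (map φ (smalls c))} {φ v} (λ { (small-placed _) → refl })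

criticalLoad-id-bound : ∀ {x cs} → All (Bounded x) cs → criticalLoad id cs ≤ fromℕ (length cs) * ((1ℚ - x) + ½)
criticalLoad-id-bound {x} [] = ≤-reflexive (sym (*-zeroˡ ((1ℚ - x) + ½)))
criticalLoad-id-bound {x} (_∷_ {c} {cs} bounded rest) = subst₂ _≤_
  (cong (λ ss → load ss + criticalLoad id cs) (sym (map-id (smalls c))))
  (trans (eq (fromℕ (length cs)) ((1ℚ - x) + ½)) (cong (_* ((1ℚ - x) + ½)) (sym (fromℕ-+ 1 (length cs)))))
  (+-mono-≤ (Bounded.loadBound bounded) (criticalLoad-id-bound rest))
  where
  eq : ∀ n b → b + n * b ≡ (1ℚ + n) * b
  eq = solve-∀ ℚ-ring

module _ {x : ℚ} where

  private
    a = 1ℚ - x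

    fold-suc : ∀ n → a + a + fromℕ n * (a + a) ≡ fromℕ (suc n) * (a + a)
    fold-suc n = trans (eq (fromℕ n) (a + a)) (cong (_* (a + a)) (sym (fromℕ-+ 1 n)))
      where
      eq : ∀ n b → b + n * b ≡ (1ℚ + n) * b
      eq = solve-∀ ℚ-ring

  criticalLoad-clipped-bound : ∀ {cs} → All (Bounded x) cs → criticalLoad (_⊓ a) cs ≤ fromℕ (length cs) * (a + a)
  criticalLoad-clipped-bound [] = ≤-reflexive (sym (*-zeroˡ (a + a)))
  criticalLoad-clipped-bound (_∷_ {c} {cs} bounded rest) = subst (criticalLoad (_⊓ a) (c ∷ cs) ≤_) (fold-suc (length cs))
    (+-mono-≤ (Bounded.clippedBound bounded) (criticalLoad-clipped-bound rest))

  -- An unfilled bin holds less than `a` of clipped size, while every other bin holds at most `2a`;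
  -- the deficit of `a` is what the assumption on `m` later exploits.
  criticalLoad-unfilled : ∀ {cs} → All (Bounded x) cs → Any (λ c → ¬ Full x c) cs →
                          criticalLoad (_⊓ a) cs + a < fromℕ (length cs) * (a + a)
  criticalLoad-unfilled (_∷_ {c} {cs} bounded rest) (here ¬full) =
    subst (criticalLoad (_⊓ a) (c ∷ cs) + a <_) (fold-suc (length cs))
      (<-from-difference (criticalLoad (_⊓ a) (c ∷ cs) + a) (a + a + fromℕ (length cs) * (a + a))
        (+-mono-<-≤
          (≤-<-trans (load-map-⊓≤load a (smalls c)) (low⇒smalls< (≰⇒> ¬full)))
          (criticalLoad-clipped-bound rest))
        (eq (load (map (_⊓ a) (smalls c))) (criticalLoad (_⊓ a) cs) a (fromℕ (length cs) * (a + a))))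
    where
    open Bounded bounded
    eq : ∀ s t a r → a + a + r - (s + t + a) ≡ a + r - (s + t)
    eq = solve-∀ ℚ-ring
  criticalLoad-unfilled (_∷_ {c} {cs} bounded rest) (there ¬full) =
    subst₂ _<_ (sym (+-assoc (load (map (_⊓ a) (smalls c))) (criticalLoad (_⊓ a) cs) a)) (fold-suc (length cs))
      (+-mono-≤-< (Bounded.clippedBound bounded) (criticalLoad-unfilled rest ¬full))

-- The invariant of a run

module Run (σ : List ℚ) (m : ℕ) {x : ℚ} (½≤x : ½ ≤ x) (x≤1 : x ≤ 1ℚ) where

  -- τ holds the items still to arrive.
  record Invariant (cs : List CriticalBin) (d s : DNF) (τ : List ℚ) : Set where
    field
      size     : length cs ≡ m
      -- Enough items of size at least `x` remain for the critical bins without one; at the end of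
      -- the input this forces `#lacking cs` to be `0`.
      lacking  : #lacking cs ℕ.≤ #atLeast x τ
      -- The big items seen so far are at most the `m - #lacking cs` in critical bins plus
      -- `#itemsOf d`, written without truncated subtraction.
      bigs     : #2-items σ ℕ.+ #lacking cs ℕ.≤ m ℕ.+ #itemsOf d ℕ.+ #2-items τ
      bigDNF   : BigDNF d
      smallDNF : SmallDNF s
      bounded  : All (Bounded x) cs
      -- The small bin stays untouched until every critical bin is full, and full bins stay full.
      overflow : s ≡ emptyDNF ⊎ All (Full x) cs
      -- Conservation of small items for every `φ`: clipping is used to fill the critical bins, the
      -- identity to count the small bins.
      loads    : ∀ φ → smallLoad φ σ ≡ criticalLoad φ cs + contentsDNF φ s + smallLoad φ τ

  -- For `k = 2` there is a single typed stream, that of the 2-items, at index `0`.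
  data Reached : State → List ℚ → Set where
    reached : ∀ {cs d s τ} → Invariant cs d s τ → Reached (state cs ((0 , d) ∷ []) s) τ

  module _ {cs d s v τ} (inv : Invariant cs d s (v ∷ τ)) (item : IsItem v) where
    open Invariant inv

    private
      st : State
      st = state cs ((0 , d) ∷ []) s

    loads-big : IsBig v → ∀ φ → smallLoad φ σ ≡ criticalLoad φ cs + contentsDNF φ s + smallLoad φ τ
    loads-big big φ = trans (loads φ) (cong (λ vs → criticalLoad φ cs + contentsDNF φ s + load (map φ vs))
      (filter-reject (isSmall? 2) {v} {τ} λ v<½ → small⇒¬big v<½ big))

    loads-small : IsSmall 2 v → ∀ φ → smallLoad φ σ ≡ criticalLoad φ cs + contentsDNF φ s + (φ v + smallLoad φ τ)
    loads-small v<½ φ = trans (loads φ) (cong (λ vs → criticalLoad φ cs + contentsDNF φ s + load (map φ vs))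
      (filter-accept (isSmall? 2) {v} {τ} v<½))

    bigs-big : IsBig v → #2-items σ ℕ.+ #lacking cs ℕ.≤ suc (m ℕ.+ #itemsOf d ℕ.+ #2-items τ)
    bigs-big big = subst (#2-items σ ℕ.+ #lacking cs ℕ.≤_)
      (trans (cong (λ vs → m ℕ.+ #itemsOf d ℕ.+ length vs) (filter-accept isBig? {v} {τ} big))
        (ℕ.+-suc (m ℕ.+ #itemsOf d) (#2-items τ)))
      bigs

    stepTyped-reached : IsBig v → #lacking cs ℕ.≤ #atLeast x τ → Reached (stepTyped 2 x st v) τ
    stepTyped-reached big lacking′ = if-does-elim (isBig? v) (λ d → Reached (state cs ((0 , d) ∷ []) s) τ)
      (λ _ → reached record
        { Invariant inv
        ; lacking = lacking′
        ; bigs    = ℕ.≤-trans (bigs-big big) (ℕ.+-monoˡ-≤ (#2-items τ)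
            (subst (ℕ._≤ m ℕ.+ #itemsOf (insertDNF v d)) (ℕ.+-suc m (#itemsOf d))
              (ℕ.+-monoʳ-≤ m (proj₂ (insertDNF-big (proj₁ big) bigDNF)))))
        ; bigDNF  = proj₁ (insertDNF-big (proj₁ big) bigDNF)
        ; loads   = loads-big big
        })
      (λ ¬big → contradiction big ¬big)

    stepLarge-reached : x ≤ v → Reached (stepLarge 2 x st v) τ
    stepLarge-reached x≤v with placeLarge-view v cs
    -- Ties at `x` can leave an item without a critical bin to take it. It goes to the 2-bin, and no
    -- critical bin lacks a large item any more.
    ... | inj₁ (eq , none) = subst (λ r → Reached (maybe′ (λ cs′ → state cs′ ((0 , d) ∷ []) s) (stepTyped 2 x st v) r) τ)
      (sym eq) (stepTyped-reached (≤-trans ½≤x x≤v , proj₂ item) (subst (ℕ._≤ #atLeast x τ) (sym none) ℕ.z≤n))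
    ... | inj₂ (cs′ , eq , u) = subst (λ r → Reached (maybe′ (λ cs′ → state cs′ ((0 , d) ∷ []) s) (stepTyped 2 x st v) r) τ)
      (sym eq) (reached record
        { Invariant inv
        ; size     = trans (Updated-length u) size
        ; lacking  = ℕ.s≤s⁻¹ (subst₂ ℕ._≤_ (#lacking-large u) (cong length (filter-accept (x ≤?_) {v} {τ} x≤v)) lacking)
        ; bigs     = ℕ.s≤s⁻¹ (subst (ℕ._≤ suc (m ℕ.+ #itemsOf d ℕ.+ #2-items τ))
            (trans (cong (#2-items σ ℕ.+_) (#lacking-large u)) (ℕ.+-suc (#2-items σ) (#lacking cs′)))
            (bigs-big big))
        ; bounded  = Updated-All (Bounded-large x≤v) u bounded
        ; overflow = Sum.map₂ (Updated-All (Full-large x≤v) u) overflow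
        ; loads    = λ φ → trans (loads-big big φ)
            (cong (λ l → l + contentsDNF φ s + smallLoad φ τ) (sym (criticalLoad-large φ u)))
        })
      where
      big : IsBig v
      big = ≤-trans ½≤x x≤v , proj₂ item

    stepSmall-reached : ¬ (x ≤ v) → IsSmall 2 v → Reached (stepSmall 2 x st v) τ
    stepSmall-reached x≰v v<½ with placeSmall-view x v cs
    ... | inj₁ (eq , full) = subst (λ r → Reached (maybe′ (λ cs′ → state cs′ ((0 , d) ∷ []) s) (state cs ((0 , d) ∷ []) (insertDNF v s)) r) τ)
      (sym eq) (reached record
        { Invariant inv
        ; lacking  = lacking-small
        ; bigs     = bigs-small
        ; smallDNF = insertDNF-small v<½ smallDNF
        ; overflow = inj₂ full
        ; loads    = λ φ → trans (loads-small v<½ φ) (trans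
            (rearrange (criticalLoad φ cs) (contentsDNF φ s) (φ v) (smallLoad φ τ))
            (cong (λ l → criticalLoad φ cs + l + smallLoad φ τ) (sym (insertDNF-contents φ v s))))
        })
      where
      lacking-small = subst (#lacking cs ℕ.≤_) (cong length (filter-reject (x ≤?_) {v} {τ} x≰v)) lacking
      bigs-small = subst (λ vs → #2-items σ ℕ.+ #lacking cs ℕ.≤ m ℕ.+ #itemsOf d ℕ.+ length vs)
        (filter-reject isBig? {v} {τ} (small⇒¬big v<½)) bigs
      rearrange : ∀ p q r t → p + q + (r + t) ≡ p + (r + q) + t
      rearrange = solve-∀ ℚ-ring
    ... | inj₂ (cs′ , eq , u) = subst (λ r → Reached (maybe′ (λ cs′ → state cs′ ((0 , d) ∷ []) s) (state cs ((0 , d) ∷ []) (insertDNF v s)) r) τ)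
      (sym eq) (reached record
        { Invariant inv
        ; size     = trans (Updated-length u) size
        ; lacking  = subst₂ ℕ._≤_ (sym (#lacking-small u)) (cong length (filter-reject (x ≤?_) {v} {τ} x≰v)) lacking
        ; bigs     = subst₂ (λ l vs → #2-items σ ℕ.+ l ℕ.≤ m ℕ.+ #itemsOf d ℕ.+ length vs)
            (sym (#lacking-small u)) (filter-reject isBig? {v} {τ} (small⇒¬big v<½)) bigs
        ; bounded  = Updated-All (Bounded-small v<½) u bounded
        -- A small item found room in a critical bin, so not all of them were full and `s` is still
        -- empty.
        ; overflow = Sum.map₂ (λ full → contradiction u (full⇒¬SmallPlaced full)) overflow
        ; loads    = λ φ → trans (loads-small v<½ φ) (trans
            (rearrange (criticalLoad φ cs) (contentsDNF φ s) (φ v) (smallLoad φ τ))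
            (cong (λ l → l + contentsDNF φ s + smallLoad φ τ) (sym (criticalLoad-small φ u))))
        })
      where
      rearrange : ∀ p q r t → p + q + (r + t) ≡ r + p + q + t
      rearrange = solve-∀ ℚ-ring

    step-reached : Reached (step 2 x st v) τ
    step-reached = if-does-elim (x ≤? v) (λ st′ → Reached st′ τ) stepLarge-reached λ x≰v →
      if-does-elim (isSmall? 2 v) (λ st′ → Reached st′ τ) (stepSmall-reached x≰v) λ v≮½ →
      stepTyped-reached (¬small⇒big item v≮½)
        (subst (#lacking cs ℕ.≤_) (cong length (filter-reject (x ≤?_) {v} {τ} x≰v)) lacking)

  run-reached : ∀ {st τ} → All IsItem τ → Reached st τ → Reached (foldl (step 2 x) st τ) []
  run-reached []             r             = r
  run-reached (item ∷ items) (reached inv) = run-reached items (step-reached inv item)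

  private
    fresh : CriticalBin
    fresh = critical nothing []

    0≤a : 0ℚ ≤ 1ℚ - x
    0≤a = p≤q⇒0≤q-p x≤1

  #lacking-fresh : ∀ n → #lacking (replicate n fresh) ≡ n
  #lacking-fresh zero    = refl
  #lacking-fresh (suc n) = cong suc (#lacking-fresh n)

  criticalLoad-fresh : ∀ φ n → criticalLoad φ (replicate n fresh) ≡ 0ℚ
  criticalLoad-fresh φ zero    = refl
  criticalLoad-fresh φ (suc n) = trans (+-identityˡ _) (criticalLoad-fresh φ n)

  initial-reached : m ℕ.≤ #atLeast x σ → Reached (initial 2 m) σ
  initial-reached m≤ = reached record
    { size     = length-replicate m
    ; lacking  = subst (ℕ._≤ #atLeast x σ) (sym (#lacking-fresh m)) m≤
    ; bigs     = ℕ.≤-reflexive (trans (cong (#2-items σ ℕ.+_) (#lacking-fresh m))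
        (trans (ℕ.+-comm (#2-items σ) m) (cong (ℕ._+ #2-items σ) (sym (ℕ.+-identityʳ m)))))
    ; bigDNF   = empty []
    ; smallDNF = record { activeLoad = *<* (ℤ.+<+ (ℕ.s≤s ℕ.z≤n)) ; closedCovered = [] ; closedLoad = ≤-reflexive refl }
    ; bounded  = All.replicate⁺ m record
        { largeBound   = ≤-refl
        ; clippedBound = +-nonNeg 0≤a 0≤a
        ; loadBound    = +-nonNeg 0≤a (*≤* (ℤ.+≤+ ℕ.z≤n))
        }
    ; overflow = inj₁ refl
    ; loads    = λ φ → sym (trans (cong (λ l → l + 0ℚ + smallLoad φ σ) (criticalLoad-fresh φ m)) (+-identityˡ (smallLoad φ σ)))
    }

-- The bins covered at the end of a run

#covered-all : ∀ {bs} → All Covered bs → #covered bs ≡ length bs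
#covered-all = cong length ∘ filter-all covered?

#covered-∷ : ∀ b bs → #covered bs ℕ.≤ #covered (b ∷ bs)
#covered-∷ b bs = subst (#covered bs ℕ.≤_) (sym (length-filter-++ covered? [ b ] bs)) (ℕ.m≤n+m (#covered bs) _)

BigDNF-closed : ∀ {d} → BigDNF d → All Covered (DNF.closed d)
BigDNF-closed (empty cov)    = cov
BigDNF-closed (single _ cov) = cov

BigDNF-#items : ∀ {d} → BigDNF d → #itemsOf d ℕ.≤ suc (2 ℕ.* length (DNF.closed d))
BigDNF-#items (empty _)    = ℕ.n≤1+n _
BigDNF-#items (single _ _) = ℕ.≤-refl

full⇒covered : ∀ {x cs} → #lacking cs ≡ 0 → All (Full x) cs → All Covered (map contents cs)
full⇒covered {cs = []}                       none []             = []
full⇒covered {cs = critical (just _) _ ∷ cs} none (full ∷ fulls) = full ∷ full⇒covered none fulls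

-- Only closed and critical bins are counted. The active 2-bin accounts for the `suc` in `bigs`, the
-- active small bin for the `1ℚ` and the strictness in `smallsBound`.
record Outcome (σ : List ℚ) (m : ℕ) (x : ℚ) : Set where
  field
    bigBins smallBins : ℕ
    covers : m ℕ.+ bigBins ℕ.+ smallBins ℕ.≤ #covered (strategy 2 m x σ)
    bigs   : #2-items σ ℕ.≤ m ℕ.+ suc (2 ℕ.* bigBins)
    smallsBound : smallLoad id σ < fromℕ m * ((1ℚ - x) + ½) + (1ℚ + fromℕ smallBins * (+ 3 / 2))

module _ (σ : List ℚ) (m : ℕ) {x : ℚ} (½≤x : ½ ≤ x) (x≤1 : x ≤ 1ℚ) where
  open Run σ m ½≤x x≤1

  -- If the small bin was used, all critical bins are full by `overflow`. Otherwise all small items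
  -- lie in critical bins, and an unfilled one would contradict the assumed clipped load by
  -- `criticalLoad-unfilled`.
  allFull : ∀ {cs d s} → Invariant cs d s [] →
            fromℕ m * ((1ℚ - x) + (1ℚ - x)) ≤ smallLoad (_⊓ (1ℚ - x)) σ + (1ℚ - x) → All (Full x) cs
  allFull {cs} inv enough with Invariant.overflow inv
  ... | inj₂ full = full
  ... | inj₁ refl with All.all? (λ c → 1ℚ ≤? virtualLoad x c) cs
  ...   | yes full = full
  ...   | no ¬full = contradiction enough (<⇒≱ (subst₂ _<_
          (cong (_+ (1ℚ - x)) (sym (trans (loads (_⊓ (1ℚ - x))) (trans (+-identityʳ _) (+-identityʳ (criticalLoad (_⊓ (1ℚ - x)) cs))))))
          (cong (λ n → fromℕ n * ((1ℚ - x) + (1ℚ - x))) size)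
          (criticalLoad-unfilled bounded (All.¬All⇒Any¬ (λ c → 1ℚ ≤? virtualLoad x c) cs ¬full))))
    where open Invariant inv

  outcome : All IsItem σ → m ℕ.≤ #atLeast x σ →
            fromℕ m * ((1ℚ - x) + (1ℚ - x)) ≤ smallLoad (_⊓ (1ℚ - x)) σ + (1ℚ - x) → Outcome σ m x
  outcome items m≤ enough with foldl (step 2 x) (initial 2 m) σ in eq
                             | run-reached items (initial-reached m≤)
  ... | .(state cs ((0 , d) ∷ []) s) | reached {cs} {d} {s} inv = record
    { bigBins   = length (DNF.closed d)
    ; smallBins = length (DNF.closed s)
    ; covers    = subst (λ st → m ℕ.+ length (DNF.closed d) ℕ.+ length (DNF.closed s) ℕ.≤ #covered (allBins st)) (sym eq) covers
    ; bigs      = ℕ.≤-trans bigs′ (ℕ.+-monoʳ-≤ m (BigDNF-#items bigDNF))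
    ; smallsBound = smalls′
    }
    where
    open Invariant inv
    open SmallDNF smallDNF

    -- With no placeholder left, virtual loads are actual loads, so full critical bins are covered.
    none : #lacking cs ≡ 0
    none = ℕ.n≤0⇒n≡0 lacking

    bigs′ : #2-items σ ℕ.≤ m ℕ.+ #itemsOf d
    bigs′ = subst₂ ℕ._≤_ (trans (cong (#2-items σ ℕ.+_) none) (ℕ.+-identityʳ _)) (ℕ.+-identityʳ _) bigs

    covers : m ℕ.+ length (DNF.closed d) ℕ.+ length (DNF.closed s) ℕ.≤ #covered (allBins (state cs ((0 , d) ∷ []) s))
    covers = begin
      m ℕ.+ length (DNF.closed d) ℕ.+ length (DNF.closed s)
        ≡⟨ cong₂ ℕ._+_ (cong₂ ℕ._+_ (sym (trans (#covered-all (full⇒covered none (allFull inv enough))) (trans (length-map contents cs) size)))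
             (sym (#covered-all (BigDNF-closed bigDNF)))) (sym (#covered-all closedCovered)) ⟩
      #covered (map contents cs) ℕ.+ #covered (DNF.closed d) ℕ.+ #covered (DNF.closed s)
        ≤⟨ ℕ.+-mono-≤ (ℕ.+-monoʳ-≤ (#covered (map contents cs)) (#covered-∷ (DNF.active d) (DNF.closed d))) (#covered-∷ (DNF.active s) (DNF.closed s)) ⟩
      #covered (map contents cs) ℕ.+ #covered (binsDNF d) ℕ.+ #covered (binsDNF s)
        ≡⟨ ℕ.+-assoc (#covered (map contents cs)) _ _ ⟩
      #covered (map contents cs) ℕ.+ (#covered (binsDNF d) ℕ.+ #covered (binsDNF s))
        ≡⟨ cong (λ bs → #covered (map contents cs) ℕ.+ (#covered bs ℕ.+ #covered (binsDNF s))) (sym (++-identityʳ (binsDNF d))) ⟩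
      #covered (map contents cs) ℕ.+ (#covered (binsDNF d ++ []) ℕ.+ #covered (binsDNF s))
        ≡⟨ cong (#covered (map contents cs) ℕ.+_) (sym (length-filter-++ covered? (binsDNF d ++ []) (binsDNF s))) ⟩
      #covered (map contents cs) ℕ.+ #covered ((binsDNF d ++ []) ++ binsDNF s)
        ≡⟨ sym (length-filter-++ covered? (map contents cs) _) ⟩
      #covered (allBins (state cs ((0 , d) ∷ []) s)) ∎
      where open ℕ.≤-Reasoning

    smalls′ : smallLoad id σ < fromℕ m * ((1ℚ - x) + ½) + (1ℚ + fromℕ (length (DNF.closed s)) * (+ 3 / 2))
    smalls′ = subst₂ _<_
      (sym (trans (loads id) (trans (+-identityʳ _) (cong (_+_ (criticalLoad id cs))
        (trans (cong load (map-id (concat (binsDNF s)))) (load-++ (DNF.active s) (concat (DNF.closed s))))))))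
      (cong (λ n → fromℕ n * ((1ℚ - x) + ½) + (1ℚ + fromℕ (length (DNF.closed s)) * (+ 3 / 2))) size)
      (+-mono-≤-< (criticalLoad-id-bound bounded) (+-mono-<-≤ activeLoad closedLoad))

-- The m-th largest item

length-filter-mono : ∀ {P Q : ℚ → Set} (P? : Decidable P) (Q? : Decidable Q) → (∀ {v} → P v → Q v) →
                     ∀ σ → length (filter P? σ) ℕ.≤ length (filter Q? σ)
length-filter-mono P? Q? P⇒Q []      = ℕ.z≤n
length-filter-mono P? Q? P⇒Q (v ∷ σ) with P? v | Q? v
... | yes _ | yes _ = ℕ.s≤s (length-filter-mono P? Q? P⇒Q σ)
... | yes p | no ¬q = contradiction (P⇒Q p) ¬q
... | no _  | yes _ = ℕ.m≤n⇒m≤1+n (length-filter-mono P? Q? P⇒Q σ)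
... | no _  | no _  = length-filter-mono P? Q? P⇒Q σ

length-filter-∷ : ∀ {P : ℚ → Set} (P? : Decidable P) v σ → length (filter P? (v ∷ σ)) ℕ.≤ suc (length (filter P? σ))
length-filter-∷ P? v σ with P? v
... | yes _ = ℕ.≤-refl
... | no _  = ℕ.n≤1+n _

-- The position `i` counts from zero. With ties, `lower` and `upper` still pin down the value at
-- that position, and they are invariant under permutation.
record Rank (x : ℚ) (i : ℕ) (σ : List ℚ) : Set where
  field
    member : x ∈ σ
    lower  : i ℕ.< #atLeast x σ
    upper  : #above x σ ℕ.≤ i

Rank-↭ : ∀ {x i σ τ} → σ ↭ τ → Rank x i σ → Rank x i τ
Rank-↭ {x} {i} σ↭τ r = record
  { member = ∈-resp-↭ σ↭τ member
  ; lower  = subst (i ℕ.<_) (length-filter-↭ (x ≤?_) σ↭τ) lower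
  ; upper  = subst (ℕ._≤ i) (length-filter-↭ (x <?_) σ↭τ) upper
  }
  where open Rank r

rank-sorted : ∀ i {ys} → AllPairs _≥_ ys → i ℕ.< length ys → Rank (fromMaybe 1ℚ (head (drop i ys))) i ys
rank-sorted zero (_∷_ {y} {ys} y≥ys _) _ = record
  { member = here refl
  ; lower  = subst (0 ℕ.<_) (cong length (sym (filter-accept (y ≤?_) {y} {ys} ≤-refl))) (ℕ.s≤s ℕ.z≤n)
  ; upper  = ℕ.≤-reflexive (cong length (filter-none (y <?_) (<-irrefl refl ∷ All.map (λ z≤y y<z → <⇒≱ y<z z≤y) y≥ys)))
  }
rank-sorted (suc i) (_∷_ {y} {ys} y≥ys sorted) (ℕ.s≤s i<) = record
  { member = there member
  ; lower  = subst (suc i ℕ.<_) (cong length (sym (filter-accept (x ≤?_) {y} {ys} (All.lookup y≥ys member)))) (ℕ.s≤s lower)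
  ; upper  = ℕ.≤-trans (length-filter-∷ (x <?_) y ys) (ℕ.s≤s upper)
  }
  where
  x = fromMaybe 1ℚ (head (drop i ys))
  open Rank (rank-sorted i sorted i<)

nthLargest-rank : ∀ σ {i} → i ℕ.< length σ → Rank (nthLargest σ (suc i)) i σ
nthLargest-rank σ {i} i< = Rank-↭ (sort-↭ order σ)
  (rank-sorted i (Sorted⇒AllPairs (DecTotalOrder.totalOrder order) (sort-↗ order σ))
    (subst (i ℕ.<_) (sym (↭-length (sort-↭ order σ))) i<))
  where order = decTotalOrder ≤-decTotalOrder

-- `few` says that fewer than `m` items exceed `x`, multiplied by `1ℚ - x` so that it also holds for
-- `m = 0`: there `x = 1` by convention and both sides vanish.
record Threshold (σ : List ℚ) (m : ℕ) (x : ℚ) : Set where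
  field
    ½≤x    : ½ ≤ x
    x≤1    : x ≤ 1ℚ
    enough : m ℕ.≤ #atLeast x σ
    few    : fromℕ (#above x σ) * (1ℚ - x) + (1ℚ - x) ≤ fromℕ m * (1ℚ - x)

nthLargest-threshold : ∀ {σ m} → All IsItem σ → m ℕ.≤ #2-items σ → Threshold σ m (nthLargest σ m)
nthLargest-threshold {σ} {zero} _ _ = record
  { ½≤x = *≤* (ℤ.+≤+ (ℕ.s≤s ℕ.z≤n))
  ; x≤1 = ≤-refl
  ; enough = ℕ.z≤n
  ; few = ≤-reflexive (cong (_+ 0ℚ) (*-zeroʳ (fromℕ (#above 1ℚ σ))))
  }
nthLargest-threshold {σ} {suc i} items i<n₂ = record
  -- If `x < ½`, all big items, more than `i` in number, would exceed `x`, against `upper`.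
  { ½≤x = ≮⇒≥ λ x<½ → ℕ.<⇒≱ i<n₂ (ℕ.≤-trans
      (length-filter-mono isBig? (x <?_) (λ (½≤v , _) → <-≤-trans x<½ ½≤v) σ) upper)
  ; x≤1 = x≤1
  ; enough = lower
  ; few = subst (_≤ fromℕ (suc i) * (1ℚ - x))
      (trans (cong (_* (1ℚ - x)) (fromℕ-+ 1 (#above x σ))) (eq (fromℕ (#above x σ)) (1ℚ - x)))
      (*-monoʳ-≤ (1ℚ - x) (p≤q⇒0≤q-p x≤1) (fromℕ-mono-≤ (ℕ.s≤s upper)))
  }
  where
  x = nthLargest σ (suc i)
  open Rank (nthLargest-rank σ (ℕ.≤-trans i<n₂ (length-filter isBig? σ)))
  x≤1 : x ≤ 1ℚ
  x≤1 = <⇒≤ (proj₂ (All.lookup items member))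
  eq : ∀ g a → (1ℚ + g) * a ≡ g * a + a
  eq = solve-∀ ℚ-ring

-- The choice of m

-- The certificate method over `ℕ`: the explicit slack `k` makes the identity free of subtraction.
ℕ-≤-from-difference : ∀ {l r} p q k → l ℕ.≤ r → q ℕ.+ l ≡ p ℕ.+ k ℕ.+ r → p ℕ.≤ q
ℕ-≤-from-difference {l} {r} p q k l≤r eq = ℕ.+-cancelʳ-≤ l p q (begin
  p ℕ.+ l         ≤⟨ ℕ.+-mono-≤ (ℕ.m≤m+n p k) l≤r ⟩
  p ℕ.+ k ℕ.+ r   ≡⟨ sym eq ⟩
  q ℕ.+ l         ∎)
  where open ℕ.≤-Reasoning

ceilingQuotient : ∀ d n → ∃[ q ] (n ℕ.≤ suc d ℕ.* q × suc d ℕ.* q ℕ.≤ n ℕ.+ d)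
ceilingQuotient d n = q , ℕ.+-cancelʳ-≤ d n (suc d ℕ.* q) n+d≤ , subst (ℕ._≤ n ℕ.+ d) (ℕ.*-comm q (suc d)) (m/n*n≤m (n ℕ.+ d) (suc d))
  where
  q = (n ℕ.+ d) ℕ./ suc d
  open ℕ.≤-Reasoning
  n+d≤ : n ℕ.+ d ℕ.≤ suc d ℕ.* q ℕ.+ d
  n+d≤ = begin
    n ℕ.+ d                              ≡⟨ m≡m%n+[m/n]*n (n ℕ.+ d) (suc d) ⟩
    (n ℕ.+ d) ℕ.% suc d ℕ.+ q ℕ.* suc d  ≤⟨ ℕ.+-monoˡ-≤ (q ℕ.* suc d) (ℕ.s≤s⁻¹ (m%n<n (n ℕ.+ d) (suc d))) ⟩
    d ℕ.+ q ℕ.* suc d                    ≡⟨ trans (ℕ.+-comm d _) (cong (ℕ._+ d) (ℕ.*-comm q (suc d))) ⟩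
    suc d ℕ.* q ℕ.+ d                    ∎

-- The two cases of the choice of m, as linear arithmetic in the numbers A, B, C
-- of bins of OPT with one, several and no big items and the numbers d₂, d of big
-- and small bins covered besides the m critical ones.

few-pure-small-bound : ∀ A B C m d₂ d → A ℕ.+ 2 ℕ.* B ℕ.≤ m ℕ.+ suc (2 ℕ.* d₂) → A ℕ.+ 2 ℕ.* C ℕ.≤ 3 ℕ.* m →
  4 ℕ.* C ℕ.+ 2 ℕ.≤ A → 3 ℕ.* (A ℕ.+ B ℕ.+ C) ℕ.≤ 5 ℕ.* (m ℕ.+ d₂ ℕ.+ d) ℕ.+ 6
few-pure-small-bound A B C m d₂ d bigs ≤3m 4C+2≤A = ℕ.*-cancelˡ-≤ 6
  (ℕ-≤-from-difference (6 ℕ.* (3 ℕ.* (A ℕ.+ B ℕ.+ C))) (6 ℕ.* (5 ℕ.* (m ℕ.+ d₂ ℕ.+ d) ℕ.+ 6))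
    (12 ℕ.* B ℕ.+ 30 ℕ.* d ℕ.+ 25)
    -- Against six times the goal, the multipliers 15, 5 and 2 bring both `A` and `C` to the
    -- coefficient 18, and both `m` and `d₂` to 30.
    (ℕ.+-mono-≤ (ℕ.+-mono-≤ (ℕ.*-monoʳ-≤ 15 bigs) (ℕ.*-monoʳ-≤ 5 ≤3m)) (ℕ.*-monoʳ-≤ 2 4C+2≤A))
    (eq A B C m d₂ d))
  where
  eq : ∀ A B C m d₂ d → 6 ℕ.* (5 ℕ.* (m ℕ.+ d₂ ℕ.+ d) ℕ.+ 6) ℕ.+
      (15 ℕ.* (A ℕ.+ 2 ℕ.* B) ℕ.+ 5 ℕ.* (A ℕ.+ 2 ℕ.* C) ℕ.+ 2 ℕ.* (4 ℕ.* C ℕ.+ 2)) ≡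
    6 ℕ.* (3 ℕ.* (A ℕ.+ B ℕ.+ C)) ℕ.+ (12 ℕ.* B ℕ.+ 30 ℕ.* d ℕ.+ 25) ℕ.+
      (15 ℕ.* (m ℕ.+ (1 ℕ.+ 2 ℕ.* d₂)) ℕ.+ 5 ℕ.* (3 ℕ.* m) ℕ.+ 2 ℕ.* A)
  eq = ℕ-solve-∀

-- Needed so that `m` is among the candidates of the oracle, as `A` is at most the number of big
-- items. If `A < m`, then `2A + 1 ≤ 2C`, against `4C + 2 ≤ A`.
few-pure-small-m≤A : ∀ A C m → 3 ℕ.* m ℕ.≤ A ℕ.+ 2 ℕ.* C ℕ.+ 2 → 4 ℕ.* C ℕ.+ 2 ℕ.≤ A → m ℕ.≤ A
few-pure-small-m≤A A C m 3m≤ 4C+2≤A = ℕ.≮⇒≥ λ A<m → ℕ.n≮0 (ℕ-≤-from-difference 1 0 (3 ℕ.* A ℕ.+ 3)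
  (ℕ.+-mono-≤ (ℕ.+-mono-≤ (ℕ.*-monoʳ-≤ 6 A<m) (ℕ.*-monoʳ-≤ 2 3m≤)) 4C+2≤A) (eq A C m))
  where
  eq : ∀ A C m → 6 ℕ.* (1 ℕ.+ A) ℕ.+ 2 ℕ.* (3 ℕ.* m) ℕ.+ (4 ℕ.* C ℕ.+ 2) ≡
    1 ℕ.+ (3 ℕ.* A ℕ.+ 3) ℕ.+ (6 ℕ.* m ℕ.+ 2 ℕ.* (A ℕ.+ 2 ℕ.* C ℕ.+ 2) ℕ.+ A)
  eq = ℕ-solve-∀

-- Against twelve times the goal, the multipliers 30, 20, 5 and 1 bring `A` and `C` to the
-- coefficient 36 and all three of `m`, `d₂` and `d` to 60.
many-pure-small-bound : ∀ A B C m d₂ d → A ℕ.+ 2 ℕ.* B ℕ.≤ m ℕ.+ suc (2 ℕ.* d₂) →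
  2 ℕ.* C ℕ.< m ℕ.+ 3 ℕ.* d ℕ.+ 2 → A ℕ.≤ 2 ℕ.* m → A ℕ.≤ 4 ℕ.* C ℕ.+ 1 →
  3 ℕ.* (A ℕ.+ B ℕ.+ C) ℕ.≤ 5 ℕ.* (m ℕ.+ d₂ ℕ.+ d) ℕ.+ 6
many-pure-small-bound A B C m d₂ d bigs 2C< A≤2m A≤4C+1 = ℕ.*-cancelˡ-≤ 12
  (ℕ-≤-from-difference (12 ℕ.* (3 ℕ.* (A ℕ.+ B ℕ.+ C))) (12 ℕ.* (5 ℕ.* (m ℕ.+ d₂ ℕ.+ d) ℕ.+ 6))
    (24 ℕ.* B ℕ.+ 21)
    (ℕ.+-mono-≤ (ℕ.+-mono-≤ (ℕ.+-mono-≤ (ℕ.*-monoʳ-≤ 30 bigs) (ℕ.*-monoʳ-≤ 20 2C<)) (ℕ.*-monoʳ-≤ 5 A≤2m)) A≤4C+1)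
    (eq A B C m d₂ d))
  where
  eq : ∀ A B C m d₂ d → 12 ℕ.* (5 ℕ.* (m ℕ.+ d₂ ℕ.+ d) ℕ.+ 6) ℕ.+
      (30 ℕ.* (A ℕ.+ 2 ℕ.* B) ℕ.+ 20 ℕ.* (1 ℕ.+ 2 ℕ.* C) ℕ.+ 5 ℕ.* A ℕ.+ A) ≡
    12 ℕ.* (3 ℕ.* (A ℕ.+ B ℕ.+ C)) ℕ.+ (24 ℕ.* B ℕ.+ 21) ℕ.+
      (30 ℕ.* (m ℕ.+ (1 ℕ.+ 2 ℕ.* d₂)) ℕ.+ 20 ℕ.* (m ℕ.+ 3 ℕ.* d ℕ.+ 2) ℕ.+ 5 ℕ.* (2 ℕ.* m) ℕ.+ (4 ℕ.* C ℕ.+ 1))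
  eq = ℕ-solve-∀

many-pure-small-m≤A : ∀ A m → 2 ℕ.* m ℕ.≤ A ℕ.+ 1 → m ℕ.≤ A
many-pure-small-m≤A A m 2m≤ = ℕ.≮⇒≥ λ A<m → ℕ.n≮0 (ℕ-≤-from-difference 1 0 A
  (ℕ.+-mono-≤ (ℕ.*-monoʳ-≤ 2 A<m) 2m≤) (eq A m))
  where
  eq : ∀ A m → 2 ℕ.* (1 ℕ.+ A) ℕ.+ 2 ℕ.* m ≡ 1 ℕ.+ A ℕ.+ (2 ℕ.* m ℕ.+ (A ℕ.+ 1))
  eq = ℕ-solve-∀

-- This is where the case distinction comes from: when `2m = A + 1`, the conclusion holds exactly
-- for `A ≤ 4C + 1`.
many-pure-small-3m≤ : ∀ A C m → 2 ℕ.* m ℕ.≤ A ℕ.+ 1 → A ℕ.≤ 4 ℕ.* C ℕ.+ 1 → 3 ℕ.* m ℕ.≤ A ℕ.+ 2 ℕ.* C ℕ.+ 2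
many-pure-small-3m≤ A C m 2m≤ A≤4C+1 = ℕ.*-cancelˡ-≤ 2
  (ℕ-≤-from-difference (2 ℕ.* (3 ℕ.* m)) (2 ℕ.* (A ℕ.+ 2 ℕ.* C ℕ.+ 2)) 0
    (ℕ.+-mono-≤ (ℕ.*-monoʳ-≤ 3 2m≤) A≤4C+1) (eq A C m))
  where
  eq : ∀ A C m → 2 ℕ.* (A ℕ.+ 2 ℕ.* C ℕ.+ 2) ℕ.+ (3 ℕ.* (2 ℕ.* m) ℕ.+ A) ≡
    2 ℕ.* (3 ℕ.* m) ℕ.+ 0 ℕ.+ (3 ℕ.* (A ℕ.+ 1) ℕ.+ (4 ℕ.* C ℕ.+ 1))
  eq = ℕ-solve-∀

-- Analysis of a chosen `m`

oracle-optimal : ∀ σ {m} → m ℕ.≤ #2-items σ → #coveredWith 2 σ m ℕ.≤ ∣DH∣ 2 σ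
oracle-optimal σ m≤n₂ = All.lookup (f[xs]≤f[argmax] ℕ.≤-totalOrder {f = #coveredWith 2 σ} 0 (upTo (suc (#2-items σ)))) (∈-upTo⁺ (ℕ.s≤s m≤n₂))

module _ {σ : List ℚ} (items : All IsItem σ) {n : ℕ} (profile : Profile n σ) where
  open Profile profile

  module _ {m : ℕ} (m≤n₂ : m ℕ.≤ #2-items σ) where
    private
      x = nthLargest σ m
      a = 1ℚ - x
      g = fromℕ (#above x σ)
      open Threshold (nthLargest-threshold items m≤n₂)
      open WeightBound (bound ½≤x x≤1)

      scaled : ∀ {j k} → j ℕ.≤ k → fromℕ j * a ≤ fromℕ k * a
      scaled j≤k = *-monoʳ-≤ a (p≤q⇒0≤q-p x≤1) (fromℕ-mono-≤ j≤k)

    -- By `clipped` and `few` the clipped load is at least `(A + 2C + 1 - m)a`, and the deficit of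
    -- an unfilled bin adds one more `a`. The sum reaches `2ma` as soon as `3m ≤ A + 2C + 2`.
    outcome-of-choice : 3 ℕ.* m ℕ.≤ (A ℕ.+ 2 ℕ.* C) ℕ.+ 2 → Outcome σ m x
    outcome-of-choice 3m≤ = outcome σ m ½≤x x≤1 items enough
      (≤-from-difference (fromℕ m * (a + a)) (smallLoad (_⊓ a) σ + a)
        (+-mono-≤ (+-mono-≤ clipped few) scaled′)
        (eq (fromℕ m) (fromℕ A) (fromℕ C) (smallLoad (_⊓ a) σ) g a))
      where
      scaled′ : (+ 3 / 1) * fromℕ m * a ≤ (fromℕ A + (+ 2 / 1) * fromℕ C + (+ 2 / 1)) * a
      scaled′ = subst₂ (λ p q → p * a ≤ q * a) (fromℕ-* 3 m)
        (trans (fromℕ-+ (A ℕ.+ 2 ℕ.* C) 2) (cong (_+ (+ 2 / 1)) (trans (fromℕ-+ A (2 ℕ.* C)) (cong (_+_ (fromℕ A)) (fromℕ-* 2 C)))))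
        (scaled 3m≤)
      eq : ∀ m A C t g a → t + a - m * (a + a) ≡
        t + g * a + m * a + (A + (+ 2 / 1) * C + (+ 2 / 1)) * a -
        (A * a + C * (a + a) + (g * a + a) + (+ 3 / 1) * m * a)
      eq = solve-∀ ℚ-ring

    -- By `plain` and `few`, `C` is at most the small load minus `(A + 1 - m)a`, hence minus `ma` as
    -- `2m ≤ A + 1`. This cancels the `ma` in `smallsBound` and leaves a bound independent of the
    -- threshold.
    smallBins-bound : 2 ℕ.* m ℕ.≤ A ℕ.+ 1 → (o : Outcome σ m x) → 2 ℕ.* C ℕ.< m ℕ.+ 3 ℕ.* Outcome.smallBins o ℕ.+ 2
    smallBins-bound 2m≤ o = fromℕ-cancel-< (subst₂ _<_ (sym (fromℕ-* 2 C))
      (sym (trans (fromℕ-+ (m ℕ.+ 3 ℕ.* smallBins) 2) (cong (_+ (+ 2 / 1)) (trans (fromℕ-+ m (3 ℕ.* smallBins)) (cong (_+_ (fromℕ m)) (fromℕ-* 3 smallBins))))))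
      (<-from-difference ((+ 2 / 1) * fromℕ C) (fromℕ m + (+ 3 / 1) * fromℕ smallBins + (+ 2 / 1))
        -- Adding `sum` to itself clears the halves.
        (+-mono-< sum sum) (eq (fromℕ m) (fromℕ A) (fromℕ C) (fromℕ smallBins) (smallLoad id σ) g a)))
      where
      open Outcome o
      scaled′ : (+ 2 / 1) * fromℕ m * a ≤ (fromℕ A + 1ℚ) * a
      scaled′ = subst₂ (λ p q → p * a ≤ q * a) (fromℕ-* 2 m) (fromℕ-+ A 1) (scaled 2m≤)
      sum : fromℕ A * a + fromℕ C * 1ℚ + (g * a + a) + (+ 2 / 1) * fromℕ m * a + smallLoad id σ <
            smallLoad id σ + g * a + fromℕ m * a + (fromℕ A + 1ℚ) * a + (fromℕ m * (a + ½) + (1ℚ + fromℕ smallBins * (+ 3 / 2)))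
      sum = +-mono-≤-< (+-mono-≤ (+-mono-≤ plain few) scaled′) smallsBound
      eq : ∀ m A C d s g a → m + (+ 3 / 1) * d + (+ 2 / 1) - (+ 2 / 1) * C ≡
        (s + g * a + m * a + (A + 1ℚ) * a + (m * (a + ½) + (1ℚ + d * (+ 3 / 2))) +
         (s + g * a + m * a + (A + 1ℚ) * a + (m * (a + ½) + (1ℚ + d * (+ 3 / 2))))) -
        (A * a + C * 1ℚ + (g * a + a) + (+ 2 / 1) * m * a + s +
         (A * a + C * 1ℚ + (g * a + a) + (+ 2 / 1) * m * a + s))
      eq = solve-∀ ℚ-ring

  A≤n₂ : A ℕ.≤ #2-items σ
  A≤n₂ = ℕ.≤-trans (ℕ.m≤m+n A (2 ℕ.* B)) bigs

  module _ {m : ℕ} (m≤A : m ℕ.≤ A) (3m≤ : 3 ℕ.* m ℕ.≤ A ℕ.+ 2 ℕ.* C ℕ.+ 2) where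

    chosen : Outcome σ m (nthLargest σ m)
    chosen = outcome-of-choice (ℕ.≤-trans m≤A A≤n₂) 3m≤

    open Outcome chosen renaming (bigs to n₂≤)

    A+2B≤ : A ℕ.+ 2 ℕ.* B ℕ.≤ m ℕ.+ suc (2 ℕ.* bigBins)
    A+2B≤ = ℕ.≤-trans bigs n₂≤

    bound-by-choice : 3 ℕ.* (A ℕ.+ B ℕ.+ C) ℕ.≤ 5 ℕ.* (m ℕ.+ bigBins ℕ.+ smallBins) ℕ.+ 6 → 3 ℕ.* n ℕ.≤ 5 ℕ.* ∣DH∣ 2 σ ℕ.+ 6
    bound-by-choice h = ℕ.≤-trans (ℕ.≤-reflexive (cong (3 ℕ.*_) total)) (ℕ.≤-trans h (ℕ.+-monoˡ-≤ 6 (ℕ.*-monoʳ-≤ 5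
      (ℕ.≤-trans covers (oracle-optimal σ (ℕ.≤-trans m≤A A≤n₂))))))

  bound-few-pure-small : 4 ℕ.* C ℕ.+ 2 ℕ.≤ A → 3 ℕ.* n ℕ.≤ 5 ℕ.* ∣DH∣ 2 σ ℕ.+ 6
  bound-few-pure-small 4C+2≤A =
    -- The argument is the divisor minus one. This is the largest `m` that `3m ≤ A + 2C + 2` admits.
    let m , ≤3m , 3m≤ = ceilingQuotient 2 (A ℕ.+ 2 ℕ.* C)
        m≤A = few-pure-small-m≤A A C m 3m≤ 4C+2≤A
        open Outcome (chosen m≤A 3m≤) using (bigBins; smallBins)
    in bound-by-choice m≤A 3m≤
         (few-pure-small-bound A B C m bigBins smallBins (A+2B≤ m≤A 3m≤) ≤3m 4C+2≤A)

  bound-many-pure-small : A ℕ.≤ 4 ℕ.* C ℕ.+ 1 → 3 ℕ.* n ℕ.≤ 5 ℕ.* ∣DH∣ 2 σ ℕ.+ 6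
  bound-many-pure-small A≤4C+1 =
    -- The largest `m` with `2m ≤ A + 1`, the condition of `smallBins-bound`.
    let m , A≤2m , 2m≤ = ceilingQuotient 1 A
        m≤A = many-pure-small-m≤A A m 2m≤
        3m≤ = many-pure-small-3m≤ A C m 2m≤ A≤4C+1
        open Outcome (chosen m≤A 3m≤) using (bigBins; smallBins)
    in bound-by-choice m≤A 3m≤
         (many-pure-small-bound A B C m bigBins smallBins (A+2B≤ m≤A 3m≤)
           (smallBins-bound (ℕ.≤-trans m≤A A≤n₂) 2m≤ (chosen m≤A 3m≤)) A≤2m A≤4C+1)

  profile-bound : 3 ℕ.* n ℕ.≤ 5 ℕ.* ∣DH∣ 2 σ ℕ.+ 6
  profile-bound = Sum.[ bound-many-pure-small , bound-few-pure-small ∘ subst (ℕ._≤ A) (sym (ℕ.+-suc (4 ℕ.* C) 1)) ]′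
    (ℕ.≤-<-connex A (4 ℕ.* C ℕ.+ 1))

-- Division by 5 gives the additive constant `6/5`, which is `19/15` less a slack of `1/15`.
ratio-bound : ∀ o d → 3 ℕ.* o ℕ.≤ 5 ℕ.* d ℕ.+ 6 → (+ 3 / 5) * fromℕ o - (+ 19 / 15) ≤ fromℕ d
ratio-bound o d 3o≤ = ≤-from-difference ((+ 3 / 5) * fromℕ o - (+ 19 / 15)) (fromℕ d)
  (+-mono-≤ (*-monoʳ-≤ (+ 1 / 5) (*≤* (ℤ.+≤+ ℕ.z≤n)) scaled) 0≤1/15)
  (eq (fromℕ o) (fromℕ d))
  where
  scaled : (+ 3 / 1) * fromℕ o ≤ (+ 5 / 1) * fromℕ d + (+ 6 / 1)
  scaled = subst₂ _≤_ (fromℕ-* 3 o)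
    (trans (fromℕ-+ (5 ℕ.* d) 6) (cong (_+ (+ 6 / 1)) (fromℕ-* 5 d)))
    (fromℕ-mono-≤ 3o≤)
  0≤1/15 : 0ℚ ≤ + 1 / 15
  0≤1/15 = *≤* (ℤ.+≤+ ℕ.z≤n)
  eq : ∀ o d → d - ((+ 3 / 5) * o - (+ 19 / 15)) ≡
    ((+ 5 / 1) * d + (+ 6 / 1)) * (+ 1 / 5) + (+ 1 / 15) - ((+ 3 / 1) * o * (+ 1 / 5) + 0ℚ)
  eq = solve-∀ ℚ-ring

theorem1 : (σ : List ℚ) → All IsItem σ →
    fromℕ (∣DH∣ 2 σ) ≥ (+ 3 / 5) * fromℕ (∣OPT∣ σ) - (+ 19 / 15)
theorem1 σ items = ratio-bound (∣OPT∣ σ) (∣DH∣ 2 σ) (profile-bound items (Profile-OPT items))
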